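{- Let $d\ge 2$ and let $p:[n]\to\mathbb R^d$ be such that $\|p(i)\|=1$ for all $i\in[n]$ and $\sum_{i=1}^n p(i)=0$. Assume that the image of $p$ contains at least three distinct points. Then the second largest eigenvalue of the stiffness matrix $L(K_n,p)$ is $n/2$.
   Context: Here $[n]=\{1,\dots,n\}$ is the vertex set of the complete graph $K_n$, and $\|\cdot\|$ is the Euclidean norm. For $p:[n]\to\mathbb R^d$ and $1\le i<j\le n$ let \[ d_{ij}=\frac{p(i)-p(j)}{\|p(i)-p(j)\|}\ \text{ if } p(i)\ne p(j),\qquad d_{ij}=0\ \text{ if } p(i)=p(j). \] Let $1_1,\dots,1_n$ be the standard basis of $\mathbb R^n$ and let $\mathbf v_{ij}=(1_i-1_j)\otimes d_{ij}\in\mathbb R^{dn}$ (Kronecker product). The normalized rigidity matrix $R(K_n,p)$ is the $dn\times\binom n2$ matrix whose columns are the vectors $\mathbf v_{ij}$, $1\le i<j\le n$. The stiffness matrix is $L(K_n,p)=R(K_n,p)R(K_n,p)^T$, a real symmetric positive semidefinite $dn\times dn$ matrix. Eigenvalues are listed in nonincreasing order, counted with multiplicity. -}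

module Defs where

open import Algebra.Bundles using (CommutativeRing)
open import Data.Bool.Base using (if_then_else_)
open import Data.Fin.Base as Fin using (Fin)
import Data.Fin.Properties as Fin
open import Data.List.Base as List using (List; allFin; cartesianProduct; filter; length)
open import Data.Nat.Base as ℕ using (ℕ; zero; suc)
open import Data.Product.Base using (∃; ∃-syntax; Σ-syntax; _×_; _,_; proj₁; uncurry)
open import Data.Sum.Base using (inj₁; inj₂)
open import Data.Vec.Functional using (Vector; replicate)
open import Function.Base using (_∘_)
open import Level using (_⊔_) renaming (suc to lsuc)
open import Relation.Binary.Core using (Rel)
open import Relation.Binary.Structures using (IsDecTotalOrder)
open import Relation.Nullary.Decidable using (Dec; yes; no; does)
open import Relation.Nullary.Negation using (¬_)
open import Relation.Unary using (Pred)

-- The field ℝ, characterised up to isomorphism as the (classical) complete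
-- ordered field.  The library has no real numbers, so everything below is
-- stated for an arbitrary model of these axioms.  The value of 0# ⁻¹ is
-- left unconstrained and is never used.

record CompleteOrderedField c ℓ : Set (lsuc (c ⊔ ℓ)) where
  infix 4 _≤_
  infix 9 _⁻¹

  field
    commutativeRing : CommutativeRing c ℓ

  open CommutativeRing commutativeRing public

  field
    _≤_             : Rel Carrier ℓ
    isDecTotalOrder : IsDecTotalOrder _≈_ _≤_
    +-monoˡ-≤       : ∀ {x y} z → x ≤ y → x + z ≤ y + z
    *-nonNeg        : ∀ {x y} → 0# ≤ x → 0# ≤ y → 0# ≤ x * y
    0≉1             : ¬ 0# ≈ 1#
    _⁻¹             : Carrier → Carrier
    *-inverseʳ      : ∀ {x} → ¬ x ≈ 0# → x * x ⁻¹ ≈ 1#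

  IsUpperBound : Pred Carrier ℓ → Pred Carrier (c ⊔ ℓ)
  IsUpperBound P u = ∀ x → P x → x ≤ u

  IsSupremum : Pred Carrier ℓ → Pred Carrier (c ⊔ ℓ)
  IsSupremum P s = IsUpperBound P s × (∀ u → IsUpperBound P u → s ≤ u)

  field
    complete : (P : Pred Carrier ℓ) → ∃ P → ∃ (IsUpperBound P) → ∃ (IsSupremum P)

  module ≤ = IsDecTotalOrder isDecTotalOrder

  open ≤ public using (_≟_; _≤?_)

module EuclideanSpace {c ℓ} (ℝ : CompleteOrderedField c ℓ) where

  open CompleteOrderedField ℝ
  open import Algebra.Definitions.RawMonoid +-rawMonoid public using (sum)
  open import Algebra.Definitions.RawMonoid +-rawMonoid using () renaming (_×_ to _×̂_)
  open import Algebra.Properties.Ring ring using (-‿distribˡ-*; -‿distribʳ-*; -‿involutive)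
  open import Data.Vec.Functional.Relation.Binary.Equality.Setoid setoid public using (_≋_)

  private

    ≤-respʳ : ∀ {x y z} → y ≈ z → x ≤ y → x ≤ z
    ≤-respʳ y≈z x≤y = ≤.trans x≤y (≤.reflexive y≈z)

    ≤-respˡ : ∀ {x y z} → x ≈ y → x ≤ z → y ≤ z
    ≤-respˡ x≈y x≤z = ≤.trans (≤.reflexive (sym x≈y)) x≤z

    x≤0⇒0≤-x : ∀ {x} → x ≤ 0# → 0# ≤ - x
    x≤0⇒0≤-x {x} x≤0 = ≤-respˡ (-‿inverseʳ x) (≤-respʳ (+-identityˡ (- x)) (+-monoˡ-≤ (- x) x≤0))

    -x*-x≈x*x : ∀ x → - x * - x ≈ x * x
    -x*-x≈x*x x = trans (sym (-‿distribˡ-* x (- x)))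
                 (trans (-‿cong (sym (-‿distribʳ-* x x)))
                        (-‿involutive (x * x)))

    square-nonNeg : ∀ x → 0# ≤ x * x
    square-nonNeg x with ≤.total 0# x
    ... | inj₁ 0≤x = *-nonNeg 0≤x 0≤x
    ... | inj₂ x≤0 = ≤-respʳ (-x*-x≈x*x x) (*-nonNeg (x≤0⇒0≤-x x≤0) (x≤0⇒0≤-x x≤0))

    0≤1 : 0# ≤ 1#
    0≤1 = ≤-respʳ (*-identityˡ 1#) (square-nonNeg 1#)

    +-nonNeg : ∀ {x y} → 0# ≤ x → 0# ≤ y → 0# ≤ x + y
    +-nonNeg {x} {y} 0≤x 0≤y = ≤.trans 0≤y (≤-respˡ (+-identityˡ y) (+-monoˡ-≤ y 0≤x))

    x-y+y≈x : ∀ x y → (x - y) + y ≈ x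
    x-y+y≈x x y = trans (+-assoc x (- y) y) (trans (+-congˡ (-‿inverseˡ y)) (+-identityʳ x))

    1≤y⇒y≤y*y : ∀ {y} → 1# ≤ y → y ≤ y * y
    1≤y⇒y≤y*y {y} 1≤y =
      ≤-respˡ (+-identityˡ y) (≤-respʳ y*[y-1]+y≈y*y (+-monoˡ-≤ y (*-nonNeg 0≤y 0≤y-1)))
      where
      0≤y : 0# ≤ y
      0≤y = ≤.trans 0≤1 1≤y
      0≤y-1 : 0# ≤ y - 1#
      0≤y-1 = ≤-respˡ (-‿inverseʳ 1#) (+-monoˡ-≤ (- 1#) 1≤y)
      y*[y-1]+y≈y*y : y * (y - 1#) + y ≈ y * y
      y*[y-1]+y≈y*y = trans (+-congˡ (sym (*-identityʳ y)))
                     (trans (sym (distribˡ y (y - 1#) 1#))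
                            (*-congˡ (x-y+y≈x y 1#)))

    x≤1+x : ∀ x → x ≤ 1# + x
    x≤1+x x = ≤-respˡ (+-identityˡ x) (+-monoˡ-≤ x 0≤1)

    y*y≤x⇒y≤1+x : ∀ {x} → 0# ≤ x → IsUpperBound (λ y → y * y ≤ x) (1# + x)
    y*y≤x⇒y≤1+x {x} 0≤x y y*y≤x with ≤.total y (1# + x)
    ... | inj₁ y≤1+x = y≤1+x
    ... | inj₂ 1+x≤y = ≤.trans (1≤y⇒y≤y*y 1≤y) (≤.trans y*y≤x (x≤1+x x))
      where
      1≤y : 1# ≤ y
      1≤y = ≤.trans (≤-respˡ (+-identityˡ 1#) (≤-respʳ (+-comm x 1#) (+-monoˡ-≤ 1# 0≤x))) 1+x≤y

    sum-nonNeg : ∀ {n} (x : Vector Carrier n) → (∀ i → 0# ≤ x i) → 0# ≤ sum x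
    sum-nonNeg {zero}  x 0≤x = ≤.refl
    sum-nonNeg {suc n} x 0≤x = +-nonNeg (0≤x Fin.zero) (sum-nonNeg (x ∘ Fin.suc) (0≤x ∘ Fin.suc))

  sqrt : ∀ x → 0# ≤ x → Carrier
  sqrt x 0≤x = proj₁ (complete (λ y → y * y ≤ x)
                               (0# , ≤-respˡ (sym (zeroˡ 0#)) 0≤x)
                               (1# + x , y*y≤x⇒y≤1+x 0≤x))

  fromℕ : ℕ → Carrier
  fromℕ n = n ×̂ 1#

  infix  8 _∙_
  infixl 6 _⊝_
  infixr 7 _•_
  infixl 7 _⊗_

  _∙_ : ∀ {n} → Vector Carrier n → Vector Carrier n → Carrier
  x ∙ y = sum λ i → x i * y i

  x∙x-nonNeg : ∀ {n} (x : Vector Carrier n) → 0# ≤ x ∙ x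
  x∙x-nonNeg x = sum-nonNeg _ (square-nonNeg ∘ x)

  ‖_‖ : ∀ {n} → Vector Carrier n → Carrier
  ‖ x ‖ = sqrt (x ∙ x) (x∙x-nonNeg x)

  𝟎 : ∀ {n} → Vector Carrier n
  𝟎 = replicate _ 0#

  _⊝_ : ∀ {n} → Vector Carrier n → Vector Carrier n → Vector Carrier n
  (x ⊝ y) i = x i - y i

  _•_ : ∀ {n} → Carrier → Vector Carrier n → Vector Carrier n
  (a • x) i = a * x i

  𝟏 : ∀ {n} → Fin n → Vector Carrier n
  𝟏 i k = if does (i Fin.≟ k) then 1# else 0#

  -- ℝᵐ ⊗ ℝⁿ is identified with ℝᵐⁿ by Fin (m * n) ≃ Fin m × Fin n.
  _⊗_ : ∀ {m n} → Vector Carrier m → Vector Carrier n → Vector Carrier (m ℕ.* n)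
  _⊗_ {m} {n} x y = uncurry (λ i j → x i * y j) ∘ Fin.remQuot {m} n

  ∑ : ∀ {m n} → Vector (Vector Carrier n) m → Vector Carrier n
  ∑ v k = sum λ i → v i k

  _≋?_ : ∀ {n} (x y : Vector Carrier n) → Dec (x ≋ y)
  x ≋? y = Fin.all? λ i → x i ≟ y i

  Matrix : ℕ → ℕ → Set c
  Matrix m n = Fin m → Fin n → Carrier

  _ᵀ : ∀ {m n} → Matrix m n → Matrix n m
  (A ᵀ) i j = A j i

  _⊛_ : ∀ {l m n} → Matrix l m → Matrix m n → Matrix l n
  (A ⊛ B) i k = sum λ j → A i j * B j k

  _·_ : ∀ {m n} → Matrix m n → Vector Carrier n → Vector Carrier m
  (A · x) i = A i ∙ x

  record IsBasis {m n p} (V : Pred (Vector Carrier n) p) (b : Vector (Vector Carrier n) m)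
         : Set (c ⊔ ℓ ⊔ p) where
    field
      member      : ∀ i → V (b i)
      independent : ∀ (a : Vector Carrier m) → ∑ (λ i → a i • b i) ≋ 𝟎 → a ≋ 𝟎
      spanning    : ∀ x → V x → Σ[ a ∈ Vector Carrier m ] x ≋ ∑ (λ i → a i • b i)

  HasDimension : ∀ {n p} → Pred (Vector Carrier n) p → ℕ → Set (c ⊔ ℓ ⊔ p)
  HasDimension V m = ∃[ b ] IsBasis {m} V b

  Eigenspace : ∀ {n} → Matrix n n → Carrier → Pred (Vector Carrier n) ℓ
  Eigenspace A μ x = A · x ≋ μ • x

  occurrences : ∀ {n} → Carrier → Vector Carrier n → ℕ
  occurrences {n} μ v = length (filter (λ k → v k ≟ μ) (allFin n))

  -- v lists the eigenvalues of A in nonincreasing order, each repeated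
  -- according to its multiplicity; a value which is not an eigenvalue has
  -- eigenspace of dimension 0, so does not occur.  For a real symmetric A
  -- geometric and algebraic multiplicities agree, and such a list exists
  -- and is unique.
  record IsEigenvalueList {n} (A : Matrix n n) (v : Vector Carrier n) : Set (c ⊔ ℓ) where
    field
      nonincreasing : ∀ {i j} → i Fin.≤ j → v j ≤ v i
      multiplicity  : ∀ μ → HasDimension (Eigenspace A μ) (occurrences μ v)

module Rigidity {c ℓ} (ℝ : CompleteOrderedField c ℓ) where

  open CompleteOrderedField ℝ
  open EuclideanSpace ℝ

  edges : ∀ n → List (Fin n × Fin n)
  edges n = filter (uncurry Fin._<?_) (cartesianProduct (allFin n) (allFin n))

  module _ {n d} (p : Vector (Vector Carrier d) n) where

    direction : Fin n → Fin n → Vector Carrier d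
    direction i j with p i ≋? p j
    ... | yes _ = 𝟎
    ... | no  _ = ‖ p i ⊝ p j ‖ ⁻¹ • (p i ⊝ p j)

    edgeVector : Fin n × Fin n → Vector Carrier (n ℕ.* d)
    edgeVector (i , j) = (𝟏 i ⊝ 𝟏 j) ⊗ direction i j

    rigidityMatrix : Matrix (n ℕ.* d) (length (edges n))
    rigidityMatrix k e = edgeVector (List.lookup (edges n) e) k

    stiffnessMatrix : Matrix (n ℕ.* d) (n ℕ.* d)
    stiffnessMatrix = rigidityMatrix ⊛ (rigidityMatrix ᵀ)

-- Write L for the stiffness matrix, δ = dᵢⱼ, and x₁, …, xₙ ∈ ℝᵈ for the blocks of x ∈ ℝᵈⁿ.  With γ = pᵢ ∙ pⱼ and
-- w = xᵢ - xⱼ, Bessel's inequality for the orthogonal vectors δ and pᵢ + pⱼ gives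
--   2 (δ ∙ w)² ≤ (1 + γ) ‖w‖² - 2 (pᵢ ∙ w) (pⱼ ∙ w).
-- Summed over all edges, every term linear in some pⱼ with j free vanishes because ∑ pⱼ = 0, and what remains is
--   2 xᵀLx ≤ n ‖x‖² + (∑ pᵢ ∙ xᵢ)² - ‖∑ xᵢ‖² - ‖∑ pᵢ ∧ xᵢ‖².
-- Since L p = n p, it follows that n is a simple eigenvalue and that all other eigenvalues are at most n / 2.
-- Finally n / 2 is attained: for u ≠ v the vector with blocks n (𝟏 u i - 𝟏 v i) pᵢ - (pᵤ - pᵥ) is an eigenvector,
-- and its block at any third vertex is nonzero when pᵤ ≠ pᵥ.

module Submission where

open import Defs
open import Algebra.Bundles using (CommutativeRing)
open import Algebra.Solver.Ring.AlmostCommutativeRing using (fromCommutativeRing; _-Raw-AlmostCommutative⟶_)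
open import Data.Bool.Base using (true; false; if_then_else_)
open import Data.Fin.Base as Fin using (Fin; toℕ)
import Data.Fin.Properties as Fin
import Data.Integer.Base as ℤ
import Data.Integer.Properties as ℤ
open import Data.List.Base as List using (List; []; _∷_)
open import Data.List.Membership.Propositional using (_∈_)
open import Data.List.Membership.Propositional.Properties using (∈-allFin; ∈-filter⁺; ∈-filter⁻; ∈-lookup)
open import Data.List.Relation.Unary.Any as Any using ()
open import Data.List.Relation.Unary.Any.Properties using (lookup-index)
open import Data.Maybe.Base using (Maybe; just; nothing)
open import Data.Nat.Base as ℕ using (ℕ; zero; suc)
open import Data.Product.Base using (_×_; ∃-syntax; _,_; proj₁; proj₂; uncurry)
open import Data.Sign.Base as Sign using (Sign)
open import Data.Sum.Base using (_⊎_; inj₁; inj₂)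
open import Data.Vec.Functional using (Vector)
open import Relation.Binary.Definitions using (tri<; tri≈; tri>)
open import Relation.Binary.PropositionalEquality.Core as ≡ using (_≡_)
open import Relation.Nullary.Decidable using (Dec; yes; no; does; dec-true; dec-false)
open import Relation.Nullary.Negation using (¬_; contradiction)

-- The obstacle is the weight 1 / ‖pᵢ - pⱼ‖² hidden in (δ ∙ w)²: while it is present, summing over j
-- never produces ∑ pⱼ. Bessel by itself only gives 2 (1 + γ) (δ ∙ w)² + (pᵢ ∙ w + pⱼ ∙ w)² ≤ 2 (1 +
-- γ) ‖w‖², whose left side still carries a factor that depends on the edge. Adding the identity 2
-- (1 - γ) (δ ∙ w)² = (pᵢ ∙ w - pⱼ ∙ w)² turns the coefficient of (δ ∙ w)² into the constant 4 and
-- leaves a bound that is polynomial in p and w. Nothing is lost on vectors with blocks aᵢ pᵢ, up to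
-- a common translation: there w lies in the span of δ and pᵢ + pⱼ, so Bessel is an equality. On
-- such vectors 2 L has blocks (n aᵢ + ∑ a) pᵢ - ∑ aⱼ pⱼ. Constant a gives the eigenvalue n, and ∑ a
-- = 0 gives n / 2 after subtracting the mean of the aⱼ pⱼ; this is where both explicit eigenvectors
-- come from.

-- Ring solver with integer coefficients

module IntegerCoefficients {c ℓ} (R : CommutativeRing c ℓ) where

  open CommutativeRing R
  open import Algebra.Properties.Ring ring
  open import Algebra.Properties.Semiring.Mult.TCOptimised semiring using (1+×; ×-homo-+; ×1-homo-*) renaming (_×_ to _×̂_)
  open import Relation.Binary.Reasoning.Setoid setoid

  private

    -- With the optimised multiple, the literals 0, 1 and 2 evaluate definitionally to `0#`, `1#`
    -- and `1# + 1#`, so solver equations with `con` match goals written with these constants.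
    ⟦_⟧ : ℤ.ℤ → Carrier
    ⟦ ℤ.+ n      ⟧ = n ×̂ 1#
    ⟦ ℤ.-[1+ n ] ⟧ = - (suc n ×̂ 1#)

    x+y-x≈y : ∀ x y → (x + y) - x ≈ y
    x+y-x≈y x y = begin
      (x + y) - x  ≈⟨ +-congʳ (+-comm x y) ⟩
      (y + x) - x  ≈⟨ +-assoc y x (- x) ⟩
      y + (x - x)  ≈⟨ +-congˡ (-‿inverseʳ x) ⟩
      y + 0#       ≈⟨ +-identityʳ y ⟩
      y            ∎

    ⟦⊖⟧ : ∀ m n → ⟦ m ℤ.⊖ n ⟧ ≈ m ×̂ 1# - n ×̂ 1#
    ⟦⊖⟧ zero    zero    = sym (-‿inverseʳ 0#)
    ⟦⊖⟧ zero    (suc n) = sym (+-identityˡ _)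
    ⟦⊖⟧ (suc m) zero    = sym (trans (+-congˡ -0#≈0#) (+-identityʳ _))
    ⟦⊖⟧ (suc m) (suc n) = begin
      ⟦ suc m ℤ.⊖ suc n ⟧                  ≡⟨ ≡.cong ⟦_⟧ (ℤ.[1+m]⊖[1+n]≡m⊖n m n) ⟩
      ⟦ m ℤ.⊖ n ⟧                          ≈⟨ ⟦⊖⟧ m n ⟩
      m ×̂ 1# - n ×̂ 1#                      ≈⟨ +-congʳ (x+y-x≈y 1# (m ×̂ 1#)) ⟨
      ((1# + m ×̂ 1#) - 1#) - n ×̂ 1#        ≈⟨ +-assoc _ _ _ ⟩
      (1# + m ×̂ 1#) + (- 1# + - (n ×̂ 1#))  ≈⟨ +-cong (sym (1+× m 1#)) (-‿+-comm 1# (n ×̂ 1#)) ⟩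
      suc m ×̂ 1# - (1# + n ×̂ 1#)           ≈⟨ +-congˡ (-‿cong (1+× n 1#)) ⟨
      suc m ×̂ 1# - suc n ×̂ 1#              ∎

    ⟦+⟧ : ∀ i j → ⟦ i ℤ.+ j ⟧ ≈ ⟦ i ⟧ + ⟦ j ⟧
    ⟦+⟧ (ℤ.+ m)      (ℤ.+ n)      = ×-homo-+ 1# m n
    ⟦+⟧ (ℤ.+ m)      ℤ.-[1+ n ]   = ⟦⊖⟧ m (suc n)
    ⟦+⟧ ℤ.-[1+ m ]   (ℤ.+ n)      = trans (⟦⊖⟧ n (suc m)) (+-comm _ _)
    ⟦+⟧ ℤ.-[1+ m ]   ℤ.-[1+ n ]   = begin
      - (suc (suc (m ℕ.+ n)) ×̂ 1#)         ≡⟨ ≡.cong (λ k → - (suc k ×̂ 1#)) (+-suc m n) ⟨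
      - ((suc m ℕ.+ suc n) ×̂ 1#)           ≈⟨ -‿cong (×-homo-+ 1# (suc m) (suc n)) ⟩
      - (suc m ×̂ 1# + suc n ×̂ 1#)          ≈⟨ -‿+-comm _ _ ⟨
      - (suc m ×̂ 1#) + - (suc n ×̂ 1#)      ∎
      where open import Data.Nat.Properties using (+-suc)

    ⟦-⟧ : ∀ i → ⟦ ℤ.- i ⟧ ≈ - ⟦ i ⟧
    ⟦-⟧ (ℤ.+ zero)    = sym -0#≈0#
    ⟦-⟧ (ℤ.+ (suc n)) = refl
    ⟦-⟧ ℤ.-[1+ n ]    = sym (-‿involutive _)

    ⟦+◃⟧ : ∀ n → ⟦ Sign.+ ℤ.◃ n ⟧ ≈ n ×̂ 1#
    ⟦+◃⟧ zero    = refl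
    ⟦+◃⟧ (suc n) = refl

    ⟦-◃⟧ : ∀ n → ⟦ Sign.- ℤ.◃ n ⟧ ≈ - (n ×̂ 1#)
    ⟦-◃⟧ zero    = sym -0#≈0#
    ⟦-◃⟧ (suc n) = refl

    ⟦*⟧ : ∀ i j → ⟦ i ℤ.* j ⟧ ≈ ⟦ i ⟧ * ⟦ j ⟧
    ⟦*⟧ (ℤ.+ m)      (ℤ.+ n)      = trans (⟦+◃⟧ (m ℕ.* n)) (×1-homo-* m n)
    ⟦*⟧ (ℤ.+ m)      ℤ.-[1+ n ]   = begin
      ⟦ Sign.- ℤ.◃ m ℕ.* suc n ⟧     ≈⟨ ⟦-◃⟧ (m ℕ.* suc n) ⟩
      - ((m ℕ.* suc n) ×̂ 1#)         ≈⟨ -‿cong (×1-homo-* m (suc n)) ⟩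
      - ((m ×̂ 1#) * (suc n ×̂ 1#))    ≈⟨ -‿distribʳ-* _ _ ⟩
      (m ×̂ 1#) * - (suc n ×̂ 1#)      ∎
    ⟦*⟧ ℤ.-[1+ m ]   (ℤ.+ n)      = begin
      ⟦ Sign.- ℤ.◃ suc m ℕ.* n ⟧     ≈⟨ ⟦-◃⟧ (suc m ℕ.* n) ⟩
      - ((suc m ℕ.* n) ×̂ 1#)         ≈⟨ -‿cong (×1-homo-* (suc m) n) ⟩
      - ((suc m ×̂ 1#) * (n ×̂ 1#))    ≈⟨ -‿distribˡ-* _ _ ⟩
      - (suc m ×̂ 1#) * (n ×̂ 1#)      ∎
    ⟦*⟧ ℤ.-[1+ m ]   ℤ.-[1+ n ]   = begin
      (suc m ℕ.* suc n) ×̂ 1#             ≈⟨ ×1-homo-* (suc m) (suc n) ⟩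
      (suc m ×̂ 1#) * (suc n ×̂ 1#)        ≈⟨ -‿involutive _ ⟨
      - - ((suc m ×̂ 1#) * (suc n ×̂ 1#))  ≈⟨ -‿cong (-‿distribʳ-* _ _) ⟩
      - ((suc m ×̂ 1#) * - (suc n ×̂ 1#))  ≈⟨ -‿distribˡ-* _ _ ⟩
      - (suc m ×̂ 1#) * - (suc n ×̂ 1#)    ∎

    morphism : ℤ.+-*-rawRing -Raw-AlmostCommutative⟶ fromCommutativeRing R
    morphism = record
      { ⟦_⟧    = ⟦_⟧
      ; +-homo = ⟦+⟧
      ; *-homo = ⟦*⟧
      ; -‿homo = ⟦-⟧
      ; 0-homo = refl
      ; 1-homo = refl
      }

    _coeff≟_ : ∀ i j → Maybe (⟦ i ⟧ ≈ ⟦ j ⟧)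
    i coeff≟ j with i ℤ.≟ j
    ... | yes i≡j = just (reflexive (≡.cong ⟦_⟧ i≡j))
    ... | no  _   = nothing

  open import Algebra.Solver.Ring ℤ.+-*-rawRing (fromCommutativeRing R) morphism _coeff≟_ public
    using (solve; con; _:=_; _:+_; _:*_; :-_; _:-_)

-- Ordered-field arithmetic and the square root

module OrderedField {c ℓ} (ℝ : CompleteOrderedField c ℓ) where

  open CompleteOrderedField ℝ
  open EuclideanSpace ℝ
  open IntegerCoefficients commutativeRing
  open import Algebra.Properties.Ring ring using (-‿distribʳ-*)
  open import Relation.Binary.Reasoning.Setoid setoid

  ≤-respˡ : ∀ {x y z} → x ≈ y → x ≤ z → y ≤ z
  ≤-respˡ x≈y x≤z = ≤.trans (≤.reflexive (sym x≈y)) x≤z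

  ≤-respʳ : ∀ {x y z} → y ≈ z → x ≤ y → x ≤ z
  ≤-respʳ y≈z x≤y = ≤.trans x≤y (≤.reflexive y≈z)

  0≤y-x⇒x≤y : ∀ {x y} → 0# ≤ y - x → x ≤ y
  0≤y-x⇒x≤y {x} {y} 0≤y-x =
    ≤-respˡ (+-identityˡ x) (≤-respʳ (solve 2 (λ x y → (y :- x) :+ x := y) refl x y) (+-monoˡ-≤ x 0≤y-x))

  x≤y⇒0≤y-x : ∀ {x y} → x ≤ y → 0# ≤ y - x
  x≤y⇒0≤y-x {x} x≤y = ≤-respˡ (-‿inverseʳ x) (+-monoˡ-≤ (- x) x≤y)

  +-mono-≤ : ∀ {w x y z} → w ≤ x → y ≤ z → w + y ≤ x + z
  +-mono-≤ {w} {x} {y} {z} w≤x y≤z = ≤.trans (+-monoˡ-≤ y w≤x)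
    (≤-respˡ (+-comm y x) (≤-respʳ (+-comm z x) (+-monoˡ-≤ x y≤z)))

  +-nonNeg : ∀ {x y} → 0# ≤ x → 0# ≤ y → 0# ≤ x + y
  +-nonNeg 0≤x 0≤y = ≤-respˡ (+-identityˡ 0#) (+-mono-≤ 0≤x 0≤y)

  x≤0⇒0≤-x : ∀ {x} → x ≤ 0# → 0# ≤ - x
  x≤0⇒0≤-x x≤0 = ≤-respʳ (+-identityˡ _) (x≤y⇒0≤y-x x≤0)

  0≤-x⇒x≤0 : ∀ {x} → 0# ≤ - x → x ≤ 0#
  0≤-x⇒x≤0 0≤-x = 0≤y-x⇒x≤y (≤-respʳ (sym (+-identityˡ _)) 0≤-x)

  square-nonNeg : ∀ x → 0# ≤ x * x
  square-nonNeg x with ≤.total 0# x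
  ... | inj₁ 0≤x = *-nonNeg 0≤x 0≤x
  ... | inj₂ x≤0 = ≤-respʳ (solve 1 (λ x → (:- x) :* (:- x) := x :* x) refl x)
                           (*-nonNeg (x≤0⇒0≤-x x≤0) (x≤0⇒0≤-x x≤0))

  0≤1 : 0# ≤ 1#
  0≤1 = ≤-respʳ (*-identityˡ 1#) (square-nonNeg 1#)

  x≉0∧xy≈0⇒y≈0 : ∀ {x y} → ¬ x ≈ 0# → x * y ≈ 0# → y ≈ 0#
  x≉0∧xy≈0⇒y≈0 {x} {y} x≉0 xy≈0 = begin
    y               ≈⟨ *-identityˡ y ⟨
    1# * y          ≈⟨ *-congʳ (*-inverseʳ x≉0) ⟨
    (x * x ⁻¹) * y  ≈⟨ solve 3 (λ x y z → (x :* z) :* y := z :* (x :* y)) refl x y (x ⁻¹) ⟩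
    x ⁻¹ * (x * y)  ≈⟨ *-congˡ xy≈0 ⟩
    x ⁻¹ * 0#       ≈⟨ zeroʳ _ ⟩
    0#              ∎

  x*x≈0⇒x≈0 : ∀ {x} → x * x ≈ 0# → x ≈ 0#
  x*x≈0⇒x≈0 {x} xx≈0 with x ≟ 0#
  ... | yes x≈0 = x≈0
  ... | no  x≉0 = x≉0∧xy≈0⇒y≈0 x≉0 xx≈0

  -- Replaces division by a positive x, with positivity split into `0# ≤ x` and `¬ x ≈ 0#`. If y ≤
  -- 0, then the product is squeezed to zero, hence so is y.
  nonNeg-cancelˡ : ∀ {x y} → 0# ≤ x → ¬ x ≈ 0# → 0# ≤ x * y → 0# ≤ y
  nonNeg-cancelˡ {x} {y} 0≤x x≉0 0≤xy with ≤.total 0# y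
  ... | inj₁ 0≤y = 0≤y
  ... | inj₂ y≤0 = ≤.reflexive (sym (x≉0∧xy≈0⇒y≈0 x≉0 (≤.antisym xy≤0 0≤xy)))
    where
    xy≤0 : x * y ≤ 0#
    xy≤0 = 0≤-x⇒x≤0 (≤-respʳ (sym (-‿distribʳ-* x y)) (*-nonNeg 0≤x (x≤0⇒0≤-x y≤0)))

  nonNeg-sum≈0 : ∀ {x y} → 0# ≤ x → 0# ≤ y → x + y ≈ 0# → x ≈ 0# × y ≈ 0#
  nonNeg-sum≈0 {x} {y} 0≤x 0≤y x+y≈0 =
    ≤.antisym (≤-respʳ x+y≈0 (≤-respˡ (+-identityʳ x) (+-mono-≤ ≤.refl 0≤y))) 0≤x ,
    ≤.antisym (≤-respʳ x+y≈0 (≤-respˡ (+-identityˡ y) (+-mono-≤ 0≤x ≤.refl))) 0≤y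

  nonNeg⇒1+x≉0 : ∀ {x} → 0# ≤ x → ¬ 1# + x ≈ 0#
  nonNeg⇒1+x≉0 0≤x 1+x≈0 = 0≉1 (sym (proj₁ (nonNeg-sum≈0 0≤1 0≤x 1+x≈0)))

  2# : Carrier
  2# = 1# + 1#

  0≤2 : 0# ≤ 2#
  0≤2 = +-nonNeg 0≤1 0≤1

  2≉0 : ¬ 2# ≈ 0#
  2≉0 = nonNeg⇒1+x≉0 0≤1

  x≤y∨y≤x∧x≉y : ∀ x y → x ≤ y ⊎ (y ≤ x × ¬ x ≈ y)
  x≤y∨y≤x∧x≉y x y with x ≤? y
  ... | yes x≤y = inj₁ x≤y
  ... | no  x≰y with ≤.total x y
  ...   | inj₁ x≤y = inj₁ x≤y
  ...   | inj₂ y≤x = inj₂ (y≤x , λ x≈y → x≰y (≤.reflexive x≈y))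

  ²-reflects-≤ : ∀ {x y} → 0# ≤ y → x * x ≤ y * y → x ≤ y
  ²-reflects-≤ {x} {y} 0≤y xx≤yy with x≤y∨y≤x∧x≉y x y
  ... | inj₁ x≤y         = x≤y
  ... | inj₂ (y≤x , x≉y) = 0≤y-x⇒x≤y (nonNeg-cancelˡ 0≤x+y x+y≉0 (≤-respʳ
          (solve 2 (λ x y → (y :* y) :- (x :* x) := (x :+ y) :* (y :- x)) refl x y) (x≤y⇒0≤y-x xx≤yy)))
    where
    0≤x : 0# ≤ x
    0≤x = ≤.trans 0≤y y≤x
    0≤x+y : 0# ≤ x + y
    0≤x+y = +-nonNeg 0≤x 0≤y
    x+y≉0 : ¬ x + y ≈ 0#
    x+y≉0 x+y≈0 with x≈0 , y≈0 ← nonNeg-sum≈0 0≤x 0≤y x+y≈0 = x≉y (trans x≈0 (sym y≈0))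

  sqrt-isSupremum : ∀ x (0≤x : 0# ≤ x) → IsSupremum (λ y → y * y ≤ x) (sqrt x 0≤x)
  sqrt-isSupremum x 0≤x = proj₂ (complete _ _ _)

  sqrt*sqrt : ∀ x (0≤x : 0# ≤ x) → sqrt x 0≤x * sqrt x 0≤x ≈ x
  sqrt*sqrt x 0≤x = ≤.antisym s*s≤x x≤s*s
    where
    s k t : Carrier
    s = sqrt x 0≤x
    isUpperBound = proj₁ (sqrt-isSupremum x 0≤x)
    isLeast = proj₂ (sqrt-isSupremum x 0≤x)

    0≤s : 0# ≤ s
    0≤s = isUpperBound 0# (≤-respˡ (sym (zeroˡ 0#)) 0≤x)

    -- The Möbius map s ↦ (k s + x) / (s + k) fixes √x and, as k² ≥ x, moves
    -- every other s ≥ 0 towards √x without crossing it.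
    k = 1# + x
    s+k≉0 : ¬ s + k ≈ 0#
    s+k≉0 s+k≈0 = nonNeg⇒1+x≉0 0≤x (proj₂ (nonNeg-sum≈0 0≤s (+-nonNeg 0≤1 0≤x) s+k≈0))
    0≤s+k : 0# ≤ s + k
    0≤s+k = +-nonNeg 0≤s (+-nonNeg 0≤1 0≤x)
    r = (s + k) ⁻¹
    [s+k]r≈1 : (s + k) * r ≈ 1#
    [s+k]r≈1 = *-inverseʳ s+k≉0
    0≤r : 0# ≤ r
    0≤r = nonNeg-cancelˡ 0≤s+k s+k≉0 (≤-respʳ (sym [s+k]r≈1) 0≤1)
    r≉0 : ¬ r ≈ 0#
    r≉0 r≈0 = 0≉1 (trans (sym (trans (*-congˡ r≈0) (zeroʳ _))) [s+k]r≈1)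
    t = (k * s + x) * r
    0≤t : 0# ≤ t
    0≤t = *-nonNeg (+-nonNeg (*-nonNeg (+-nonNeg 0≤1 0≤x) 0≤s) 0≤x) 0≤r

    t-s : t - s ≈ r * (x - s * s)
    t-s = begin
      -- Inserting the factor (s + k) r ≈ 1 makes both sides polynomials in x, s, k and r, so the
      -- solver can treat r as a free variable.
      t - s                     ≈⟨ +-congˡ (-‿cong (trans (sym (*-identityʳ s)) (*-congˡ (sym [s+k]r≈1)))) ⟩
      t - s * ((s + k) * r)     ≈⟨ solve 4 (λ x s k r → (k :* s :+ x) :* r :- s :* ((s :+ k) :* r) := r :* (x :- s :* s)) refl x s k r ⟩
      r * (x - s * s)           ∎

    -- The factor `1# + x + x * x` is k² - x; since it is nonnegative, t² stays on the same side of
    -- x as s².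
    x-t² : x - t * t ≈ ((1# + x + x * x) * (r * r)) * (x - s * s)
    x-t² = begin
      x - t * t
        ≈⟨ +-congʳ (trans (sym (*-identityʳ x)) (*-congˡ (sym (trans (*-cong [s+k]r≈1 [s+k]r≈1) (*-identityˡ 1#))))) ⟩
      x * (((s + k) * r) * ((s + k) * r)) - t * t
        ≈⟨ solve 3 (λ x s r → let k = con ℤ.1ℤ :+ x in
             x :* (((s :+ k) :* r) :* ((s :+ k) :* r)) :- ((k :* s :+ x) :* r) :* ((k :* s :+ x) :* r)
             := ((con ℤ.1ℤ :+ x :+ x :* x) :* (r :* r)) :* (x :- s :* s)) refl x s r ⟩
      ((1# + x + x * x) * (r * r)) * (x - s * s) ∎

    0≤factor : 0# ≤ (1# + x + x * x) * (r * r)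
    0≤factor = *-nonNeg (+-nonNeg (+-nonNeg 0≤1 0≤x) (square-nonNeg x)) (square-nonNeg r)

    -- If s² ≤ x, then t is again a member of the set whose supremum is s, so t ≤ s, and the formula
    -- for t - s reverses the inequality.
    x≤s*s : x ≤ s * s
    x≤s*s with ≤.total x (s * s)
    ... | inj₁ x≤ss = x≤ss
    ... | inj₂ ss≤x = 0≤y-x⇒x≤y (nonNeg-cancelˡ 0≤r r≉0 (≤-respʳ eq (x≤y⇒0≤y-x t≤s)))
      where
      t≤s : t ≤ s
      t≤s = isUpperBound t (0≤y-x⇒x≤y (≤-respʳ (sym x-t²) (*-nonNeg 0≤factor (x≤y⇒0≤y-x ss≤x))))
      eq : s - t ≈ r * (s * s - x)
      eq = begin
        s - t              ≈⟨ solve 2 (λ s t → s :- t := :- (t :- s)) refl s t ⟩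
        - (t - s)          ≈⟨ -‿cong t-s ⟩
        - (r * (x - s * s)) ≈⟨ solve 3 (λ r x y → :- (r :* (x :- y)) := r :* (y :- x)) refl r x (s * s) ⟩
        r * (s * s - x)    ∎

    -- Dually, if x ≤ s², then x ≤ t², so t is an upper bound of the set and leastness gives s ≤ t.
    s*s≤x : s * s ≤ x
    s*s≤x with ≤.total (s * s) x
    ... | inj₁ ss≤x = ss≤x
    ... | inj₂ x≤ss = 0≤y-x⇒x≤y (nonNeg-cancelˡ 0≤r r≉0 (≤-respʳ t-s (x≤y⇒0≤y-x s≤t)))
      where
      x≤tt : x ≤ t * t
      x≤tt = 0≤y-x⇒x≤y (≤-respʳ eq (*-nonNeg 0≤factor (x≤y⇒0≤y-x x≤ss)))
        where
        eq : ((1# + x + x * x) * (r * r)) * (s * s - x) ≈ t * t - x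
        eq = begin
          ((1# + x + x * x) * (r * r)) * (s * s - x)
            ≈⟨ solve 3 (λ f x y → f :* (y :- x) := :- (f :* (x :- y))) refl _ x (s * s) ⟩
          - (((1# + x + x * x) * (r * r)) * (x - s * s)) ≈⟨ -‿cong x-t² ⟨
          - (x - t * t) ≈⟨ solve 2 (λ x y → :- (x :- y) := y :- x) refl x (t * t) ⟩
          t * t - x ∎
      s≤t : s ≤ t
      s≤t = isLeast t (λ y yy≤x → ²-reflects-≤ 0≤t (≤.trans yy≤x x≤tt))

  ‖x‖*‖x‖≈x∙x : ∀ {n} (x : Vector Carrier n) → ‖ x ‖ * ‖ x ‖ ≈ x ∙ x
  ‖x‖*‖x‖≈x∙x x = sqrt*sqrt (x ∙ x) (x∙x-nonNeg x)

  0≤fromℕ : ∀ n → 0# ≤ fromℕ n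
  0≤fromℕ zero    = ≤.refl
  0≤fromℕ (suc n) = +-nonNeg 0≤1 (0≤fromℕ n)

  fromℕ-suc≉0 : ∀ n → ¬ fromℕ (suc n) ≈ 0#
  fromℕ-suc≉0 n = nonNeg⇒1+x≉0 (0≤fromℕ n)

-- Finite sums and sums over edges

module Summation {c ℓ} (ℝ : CompleteOrderedField c ℓ) where

  open CompleteOrderedField ℝ
  open EuclideanSpace ℝ
  open Rigidity ℝ using (edges)
  open OrderedField ℝ
  open IntegerCoefficients commutativeRing
  open import Algebra.Properties.Ring ring using (-‿+-comm; -0#≈0#)
  open import Algebra.Properties.Semiring.Mult semiring using (×-assoc-*; ×-congʳ)
  open import Algebra.Properties.Semiring.Sum semiring public
    using (sum-cong-≋; sum-replicate; sum-replicate-zero; ∑-distrib-+; ∑-comm; *-distribˡ-sum; *-distribʳ-sum)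
  open import Relation.Binary.Reasoning.Setoid setoid

  sum-const : ∀ n x → sum {n} (λ _ → x) ≈ fromℕ n * x
  sum-const n x = begin
    sum {n} (λ _ → x)  ≈⟨ sum-replicate n ⟩
    _                  ≈⟨ ×-congʳ n (*-identityˡ x) ⟨
    _                  ≈⟨ ×-assoc-* n 1# x ⟨
    fromℕ n * x        ∎

  sum-neg : ∀ {n} (f : Vector Carrier n) → sum (λ i → - f i) ≈ - sum f
  sum-neg {zero}  f = sym -0#≈0#
  sum-neg {suc n} f = trans (+-congˡ (sum-neg (λ i → f (Fin.suc i)))) (-‿+-comm _ _)

  sum-sub : ∀ {n} (f g : Vector Carrier n) → sum (λ i → f i - g i) ≈ sum f - sum g
  sum-sub f g = trans (∑-distrib-+ f (λ i → - g i)) (+-congˡ (sum-neg g))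

  sum-nonNeg : ∀ {n} (f : Vector Carrier n) → (∀ i → 0# ≤ f i) → 0# ≤ sum f
  sum-nonNeg {zero}  f 0≤f = ≤.refl
  sum-nonNeg {suc n} f 0≤f = +-nonNeg (0≤f Fin.zero) (sum-nonNeg _ (λ i → 0≤f (Fin.suc i)))

  sum-mono-≤ : ∀ {n} {f g : Vector Carrier n} → (∀ i → f i ≤ g i) → sum f ≤ sum g
  sum-mono-≤ {f = f} {g} f≤g = 0≤y-x⇒x≤y (≤-respʳ (sum-sub g f) (sum-nonNeg _ (λ i → x≤y⇒0≤y-x (f≤g i))))

  sum-nonNeg≈0 : ∀ {n} (f : Vector Carrier n) → (∀ i → 0# ≤ f i) → sum f ≈ 0# → ∀ i → f i ≈ 0#
  sum-nonNeg≈0 {suc n} f 0≤f ∑f≈0 i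
    with f₀≈0 , ∑≈0 ← nonNeg-sum≈0 (0≤f Fin.zero) (sum-nonNeg _ (λ i → 0≤f (Fin.suc i))) ∑f≈0
    with i
  ... | Fin.zero  = f₀≈0
  ... | Fin.suc j = sum-nonNeg≈0 _ (λ i → 0≤f (Fin.suc i)) ∑≈0 j

  sum*sum : ∀ {m n} (f : Vector Carrier m) (g : Vector Carrier n) →
            sum f * sum g ≈ sum λ i → sum λ j → f i * g j
  sum*sum f g = trans (*-distribʳ-sum (sum g) f) (sum-cong-≋ λ i → *-distribˡ-sum (f i) g)

  sum-0*ˡ : ∀ {n} (f : Vector Carrier n) → sum (λ i → 0# * f i) ≈ 0#
  sum-0*ˡ f = trans (sym (*-distribˡ-sum 0# f)) (zeroˡ _)

  sum-𝟏ˡ : ∀ {n} i (f : Vector Carrier n) → sum (λ k → 𝟏 i k * f k) ≈ f i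
  sum-𝟏ˡ Fin.zero    f = trans (+-cong (*-identityˡ _) (sum-0*ˡ (λ k → f (Fin.suc k)))) (+-identityʳ _)
  sum-𝟏ˡ (Fin.suc i) f = trans (+-cong (zeroˡ _) (sum-𝟏ˡ i (λ k → f (Fin.suc k)))) (+-identityˡ _)

  sum-𝟏ʳ : ∀ {n} k (f : Vector Carrier n) → sum (λ i → 𝟏 i k * f i) ≈ f k
  sum-𝟏ʳ Fin.zero    f = trans (+-cong (*-identityˡ _) (sum-0*ˡ (λ k → f (Fin.suc k)))) (+-identityʳ _)
  sum-𝟏ʳ (Fin.suc i) f = trans (+-cong (zeroˡ _) (sum-𝟏ʳ i (λ k → f (Fin.suc k)))) (+-identityˡ _)

  sum-+ : ∀ m {n} (f : Vector Carrier (m ℕ.+ n)) →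
          sum f ≈ sum (λ i → f (i Fin.↑ˡ n)) + sum (λ j → f (m Fin.↑ʳ j))
  sum-+ zero    f = sym (+-identityˡ _)
  sum-+ (suc m) f = trans (+-congˡ (sum-+ m (λ i → f (Fin.suc i)))) (sym (+-assoc _ _ _))

  sum-combine : ∀ m {n} (f : Vector Carrier (m ℕ.* n)) →
                sum f ≈ sum λ i → sum λ j → f (Fin.combine {m} i j)
  sum-combine zero        f = refl
  sum-combine (suc m) {n} f = trans (sum-+ n f) (+-congˡ (sum-combine m (λ i → f (n Fin.↑ʳ i))))

  ∑-comm₄ : ∀ {m n} (f : Fin m → Fin m → Fin n → Fin n → Carrier) →
            (sum λ i → sum λ j → sum λ k → sum λ l → f i j k l) ≈
            (sum λ k → sum λ l → sum λ i → sum λ j → f i j k l)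
  ∑-comm₄ f = begin
    (sum λ i → sum λ j → sum λ k → sum λ l → f i j k l)
      ≈⟨ sum-cong-≋ (λ i → ∑-comm (λ j k → sum λ l → f i j k l)) ⟩
    (sum λ i → sum λ k → sum λ j → sum λ l → f i j k l)
      ≈⟨ ∑-comm (λ i k → sum λ j → sum λ l → f i j k l) ⟩
    (sum λ k → sum λ i → sum λ j → sum λ l → f i j k l)
      ≈⟨ sum-cong-≋ (λ k → sum-cong-≋ λ i → ∑-comm (λ j l → f i j k l)) ⟩
    (sum λ k → sum λ i → sum λ l → sum λ j → f i j k l)
      ≈⟨ sum-cong-≋ (λ k → ∑-comm (λ i l → sum λ j → f i j k l)) ⟩
    (sum λ k → sum λ l → sum λ i → sum λ j → f i j k l) ∎

  -- The sum is half the squared norm of the antisymmetrization of M.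
  antisymmetrization-nonNeg : ∀ {n} (M : Matrix n n) →
    0# ≤ sum λ k → sum λ l → M k l * M k l - M l k * M k l
  antisymmetrization-nonNeg M = nonNeg-cancelˡ 0≤2 2≉0
    (≤-respʳ eq (sum-nonNeg _ λ k → sum-nonNeg _ λ l → square-nonNeg (M k l - M l k)))
    where
    g = λ k l → M k l * M k l - M l k * M k l
    eq : (sum λ k → sum λ l → (M k l - M l k) * (M k l - M l k)) ≈ 2# * (sum λ k → sum λ l → g k l)
    eq = begin
      (sum λ k → sum λ l → (M k l - M l k) * (M k l - M l k))
        ≈⟨ sum-cong-≋ (λ k → sum-cong-≋ λ l →
             solve 2 (λ x y → (x :- y) :* (x :- y) := (x :* x :- y :* x) :+ (y :* y :- x :* y)) refl (M k l) (M l k)) ⟩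
      (sum λ k → sum λ l → g k l + g l k)
        ≈⟨ sum-cong-≋ (λ k → ∑-distrib-+ (g k) (λ l → g l k)) ⟩
      (sum λ k → sum (g k) + sum λ l → g l k)
        ≈⟨ ∑-distrib-+ (λ k → sum (g k)) (λ k → sum λ l → g l k) ⟩
      (sum λ k → sum (g k)) + (sum λ k → sum λ l → g l k)
        ≈⟨ +-congˡ (∑-comm (λ k l → g l k)) ⟩
      (sum λ k → sum (g k)) + (sum λ k → sum (g k))
        ≈⟨ solve 1 (λ x → x :+ x := con (ℤ.+ 2) :* x) refl _ ⟩
      2# * (sum λ k → sum λ l → g k l) ∎

  -- Summing over positions makes this definitionally the sum over the columns of `rigidityMatrix`
  -- when the list is `edges n`.
  sumOver : ∀ {a} {A : Set a} → (A → Carrier) → List A → Carrier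
  sumOver f xs = sum λ e → f (List.lookup xs e)

  *-distribˡ-sumOver : ∀ {a} {A : Set a} x (f : A → Carrier) xs → x * sumOver f xs ≈ sumOver (λ y → x * f y) xs
  *-distribˡ-sumOver x f xs = *-distribˡ-sum x (λ e → f (List.lookup xs e))

  sumOver-filter : ∀ {a p} {A : Set a} {P : A → Set p} (P? : ∀ x → Dec (P x)) (f : A → Carrier) xs →
                   sumOver f (List.filter P? xs) ≈ sumOver (λ x → if does (P? x) then f x else 0#) xs
  sumOver-filter P? f []       = refl
  sumOver-filter P? f (x ∷ xs) with does (P? x)
  ... | true  = +-congˡ (sumOver-filter P? f xs)
  ... | false = trans (sumOver-filter P? f xs) (sym (+-identityˡ _))

  sumOver-++ : ∀ {a} {A : Set a} (f : A → Carrier) xs ys →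
               sumOver f (xs List.++ ys) ≈ sumOver f xs + sumOver f ys
  sumOver-++ f []       ys = sym (+-identityˡ _)
  sumOver-++ f (x ∷ xs) ys = trans (+-congˡ (sumOver-++ f xs ys)) (sym (+-assoc _ _ _))

  sumOver-map : ∀ {a b} {A : Set a} {B : Set b} (f : B → Carrier) (g : A → B) xs →
                sumOver f (List.map g xs) ≈ sumOver (λ x → f (g x)) xs
  sumOver-map f g []       = refl
  sumOver-map f g (x ∷ xs) = +-congˡ (sumOver-map f g xs)

  sumOver-cartesianProduct : ∀ {a b} {A : Set a} {B : Set b} (f : A × B → Carrier) xs ys →
    sumOver f (List.cartesianProduct xs ys) ≈ sumOver (λ x → sumOver (λ y → f (x , y)) ys) xs
  sumOver-cartesianProduct f []       ys = refl
  sumOver-cartesianProduct f (x ∷ xs) ys = trans (sumOver-++ f (List.map (x ,_) ys) _)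
    (+-cong (sumOver-map f (x ,_) ys) (sumOver-cartesianProduct f xs ys))

  sumOver-tabulate : ∀ {a} {A : Set a} {n} (f : A → Carrier) (g : Fin n → A) →
                     sumOver f (List.tabulate g) ≈ sum λ i → f (g i)
  sumOver-tabulate {n = zero}  f g = refl
  sumOver-tabulate {n = suc n} f g = +-congˡ (sumOver-tabulate f (λ i → g (Fin.suc i)))

  -- The diagonal indicator has the form `𝟏 i j * x` so that its sum over j is evaluated by
  -- `sum-𝟏ˡ`.
  trichotomy : ∀ {n} (i j : Fin n) x →
    (if does (i Fin.<? j) then x else 0#) + (if does (j Fin.<? i) then x else 0#) + 𝟏 i j * x ≈ x
  trichotomy i j x with Fin.<-cmp i j
  ... | tri< i<j i≢j j≮i
    rewrite dec-true (i Fin.<? j) i<j | dec-false (j Fin.<? i) j≮i | dec-false (i Fin.≟ j) i≢j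
    = solve 1 (λ x → x :+ con ℤ.0ℤ :+ con ℤ.0ℤ :* x := x) refl x
  ... | tri≈ i≮j i≡j j≮i
    rewrite dec-false (i Fin.<? j) i≮j | dec-false (j Fin.<? i) j≮i | dec-true (i Fin.≟ j) i≡j
    = solve 1 (λ x → con ℤ.0ℤ :+ con ℤ.0ℤ :+ con ℤ.1ℤ :* x := x) refl x
  ... | tri> i≮j i≢j j<i
    rewrite dec-false (i Fin.<? j) i≮j | dec-true (j Fin.<? i) j<i | dec-false (i Fin.≟ j) i≢j
    = solve 1 (λ x → con ℤ.0ℤ :+ x :+ con ℤ.0ℤ :* x := x) refl x

  -- Trades edges for ordered pairs, so that j runs over all vertices and `centred` becomes
  -- applicable. Swapping the summation variables moves the `f j i` terms to the pairs with j < i,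
  -- and the missing diagonal contributes zero.
  sumOver-edges : ∀ {n} (f : Fin n → Fin n → Carrier) → (∀ i → f i i ≈ 0#) →
                  sumOver (λ (i , j) → f i j + f j i) (edges n) ≈ sum λ i → sum λ j → f i j
  sumOver-edges {n} f fᵢᵢ≈0 = begin
    sumOver g (edges n)
      ≈⟨ sumOver-filter (uncurry Fin._<?_) g (List.cartesianProduct (List.allFin n) (List.allFin n)) ⟩
    sumOver g< (List.cartesianProduct (List.allFin n) (List.allFin n))
      ≈⟨ sumOver-cartesianProduct g< (List.allFin n) (List.allFin n) ⟩
    sumOver (λ i → sumOver (λ j → g< (i , j)) (List.allFin n)) (List.allFin n)
      ≈⟨ sumOver-tabulate (λ i → sumOver (λ j → g< (i , j)) (List.allFin n)) (λ i → i) ⟩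
    (sum λ i → sumOver (λ j → g< (i , j)) (List.allFin n))
      ≈⟨ sum-cong-≋ (λ i → sumOver-tabulate (λ j → g< (i , j)) (λ j → j)) ⟩
    (sum λ i → sum λ j → g< (i , j))
      ≈⟨ sum-cong-≋ (λ i → trans (sum-cong-≋ (λ j → split i j)) (∑-distrib-+ (λ j → [ i < j ] f i j) _)) ⟩
    (sum λ i → (sum λ j → [ i < j ] f i j) + (sum λ j → [ i < j ] f j i))
      ≈⟨ ∑-distrib-+ (λ i → sum λ j → [ i < j ] f i j) _ ⟩
    (sum λ i → sum λ j → [ i < j ] f i j) + (sum λ i → sum λ j → [ i < j ] f j i)
      ≈⟨ +-congˡ (∑-comm (λ i j → [ i < j ] f j i)) ⟩
    (sum λ i → sum λ j → [ i < j ] f i j) + (sum λ i → sum λ j → [ j < i ] f i j)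
      ≈⟨ ∑-distrib-+ (λ i → sum λ j → [ i < j ] f i j) _ ⟨
    (sum λ i → (sum λ j → [ i < j ] f i j) + (sum λ j → [ j < i ] f i j))
      ≈⟨ sum-cong-≋ (λ i → trans (sym (+-identityʳ _)) (+-cong (sym (∑-distrib-+ (λ j → [ i < j ] f i j) _))
           (sym (trans (sum-𝟏ˡ i (f i)) (fᵢᵢ≈0 i))))) ⟩
    (sum λ i → (sum λ j → [ i < j ] f i j + [ j < i ] f i j) + (sum λ j → 𝟏 i j * f i j))
      ≈⟨ sum-cong-≋ (λ i → ∑-distrib-+ (λ j → [ i < j ] f i j + [ j < i ] f i j) _) ⟨
    (sum λ i → sum λ j → [ i < j ] f i j + [ j < i ] f i j + 𝟏 i j * f i j)
      ≈⟨ sum-cong-≋ (λ i → sum-cong-≋ λ j → trichotomy i j (f i j)) ⟩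
    (sum λ i → sum λ j → f i j) ∎
    where
    [_<_]_ : Fin n → Fin n → Carrier → Carrier
    [ i < j ] x = if does (i Fin.<? j) then x else 0#
    g g< : Fin n × Fin n → Carrier
    g (i , j) = f i j + f j i
    g< (i , j) = [ i < j ] (f i j + f j i)
    split : ∀ i j → g< (i , j) ≈ [ i < j ] f i j + [ i < j ] f j i
    split i j with does (i Fin.<? j)
    ... | true  = refl
    ... | false = sym (+-identityˡ 0#)

-- Inner products, Cauchy-Schwarz and bivector norms

module InnerProduct {c ℓ} (ℝ : CompleteOrderedField c ℓ) where

  open CompleteOrderedField ℝ
  open EuclideanSpace ℝ
  open OrderedField ℝ
  open Summation ℝ
  open IntegerCoefficients commutativeRing
  open import Relation.Binary.Reasoning.Setoid setoid

  infixl 6 _⊞_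

  _⊞_ : ∀ {n} → Vector Carrier n → Vector Carrier n → Vector Carrier n
  (x ⊞ y) i = x i + y i

  ∙-cong : ∀ {n} {x x′ y y′ : Vector Carrier n} → x ≋ x′ → y ≋ y′ → x ∙ y ≈ x′ ∙ y′
  ∙-cong x≋x′ y≋y′ = sum-cong-≋ λ i → *-cong (x≋x′ i) (y≋y′ i)

  ∙-comm : ∀ {n} (x y : Vector Carrier n) → x ∙ y ≈ y ∙ x
  ∙-comm x y = sum-cong-≋ λ i → *-comm (x i) (y i)

  ∙-⊞ʳ : ∀ {n} (x y z : Vector Carrier n) → x ∙ (y ⊞ z) ≈ x ∙ y + x ∙ z
  ∙-⊞ʳ x y z = trans (sum-cong-≋ λ i → distribˡ (x i) (y i) (z i)) (∑-distrib-+ (λ i → x i * y i) _)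

  ∙-⊝ʳ : ∀ {n} (x y z : Vector Carrier n) → x ∙ (y ⊝ z) ≈ x ∙ y - x ∙ z
  ∙-⊝ʳ x y z = trans
    (sum-cong-≋ λ i → solve 3 (λ x y z → x :* (y :- z) := x :* y :- x :* z) refl (x i) (y i) (z i))
    (sum-sub (λ i → x i * y i) _)

  ∙-•ʳ : ∀ {n} (x : Vector Carrier n) a y → x ∙ (a • y) ≈ a * (x ∙ y)
  ∙-•ʳ x a y = trans
    (sum-cong-≋ λ i → solve 3 (λ x a y → x :* (a :* y) := a :* (x :* y)) refl (x i) a (y i))
    (sym (*-distribˡ-sum a (λ i → x i * y i)))

  ∙-⊞ˡ : ∀ {n} (x y z : Vector Carrier n) → (x ⊞ y) ∙ z ≈ x ∙ z + y ∙ z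
  ∙-⊞ˡ x y z = trans (∙-comm (x ⊞ y) z) (trans (∙-⊞ʳ z x y) (+-cong (∙-comm z x) (∙-comm z y)))

  ∙-⊝ˡ : ∀ {n} (x y z : Vector Carrier n) → (x ⊝ y) ∙ z ≈ x ∙ z - y ∙ z
  ∙-⊝ˡ x y z = trans (∙-comm (x ⊝ y) z)
    (trans (∙-⊝ʳ z x y) (+-cong (∙-comm z x) (-‿cong (∙-comm z y))))

  ∙-•ˡ : ∀ {n} a (x y : Vector Carrier n) → (a • x) ∙ y ≈ a * (x ∙ y)
  ∙-•ˡ a x y = trans (∙-comm (a • x) y) (trans (∙-•ʳ y a x) (*-congˡ (∙-comm y x)))

  ∙-∑ʳ : ∀ {m n} (x : Vector Carrier n) (y : Vector (Vector Carrier n) m) → x ∙ ∑ y ≈ sum λ i → x ∙ y i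
  ∙-∑ʳ x y = trans (sum-cong-≋ λ k → *-distribˡ-sum (x k) (λ i → y i k)) (∑-comm (λ k i → x k * y i k))

  x∙x≈0⇒x≋𝟎 : ∀ {n} (x : Vector Carrier n) → x ∙ x ≈ 0# → x ≋ 𝟎
  x∙x≈0⇒x≋𝟎 x x∙x≈0 i = x*x≈0⇒x≈0 (sum-nonNeg≈0 _ (λ i → square-nonNeg (x i)) x∙x≈0 i)

  -- Lagrange's identity: the defect is the squared norm of the bivector x ∧ y, obtained by
  -- antisymmetrizing the rank-one matrix with entries x k * y l.
  cauchySchwarz : ∀ {n} (x y : Vector Carrier n) → (x ∙ y) * (x ∙ y) ≤ (x ∙ x) * (y ∙ y)
  cauchySchwarz x y = 0≤y-x⇒x≤y (≤-respʳ eq (antisymmetrization-nonNeg (λ k l → x k * y l)))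
    where
    eq : (sum λ k → sum λ l → (x k * y l) * (x k * y l) - (x l * y k) * (x k * y l))
         ≈ (x ∙ x) * (y ∙ y) - (x ∙ y) * (x ∙ y)
    eq = begin
      (sum λ k → sum λ l → (x k * y l) * (x k * y l) - (x l * y k) * (x k * y l))
        ≈⟨ sum-cong-≋ (λ k → sum-cong-≋ λ l →
             solve 4 (λ a b c d → (a :* d) :* (a :* d) :- (b :* c) :* (a :* d) := (a :* a) :* (d :* d) :- (a :* c) :* (b :* d))
               refl (x k) (x l) (y k) (y l)) ⟩
      (sum λ k → sum λ l → (x k * x k) * (y l * y l) - (x k * y k) * (x l * y l))
        ≈⟨ sum-cong-≋ (λ k → sum-sub (λ l → (x k * x k) * (y l * y l)) _) ⟩
      (sum λ k → (sum λ l → (x k * x k) * (y l * y l)) - (sum λ l → (x k * y k) * (x l * y l)))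
        ≈⟨ sum-sub (λ k → sum λ l → (x k * x k) * (y l * y l)) _ ⟩
      (sum λ k → sum λ l → (x k * x k) * (y l * y l)) - (sum λ k → sum λ l → (x k * y k) * (x l * y l))
        ≈⟨ +-cong (sum*sum (λ k → x k * x k) (λ l → y l * y l)) (-‿cong (sum*sum (λ k → x k * y k) (λ l → x l * y l))) ⟨
      (x ∙ x) * (y ∙ y) - (x ∙ y) * (x ∙ y) ∎

  -- The sum is the squared norm of the bivector ∑ᵢ y i ∧ x i.
  wedge-nonNeg : ∀ {m n} (x y : Vector (Vector Carrier n) m) →
    0# ≤ sum λ i → sum λ j → (y i ∙ y j) * (x i ∙ x j) - (y j ∙ x i) * (y i ∙ x j)
  wedge-nonNeg {m} {n} x y = ≤-respʳ (sym eq) (antisymmetrization-nonNeg M)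
    where
    M : Matrix n n
    M k l = sum λ i → y i k * x i l
    eq : (sum λ i → sum λ j → (y i ∙ y j) * (x i ∙ x j) - (y j ∙ x i) * (y i ∙ x j))
         ≈ (sum λ k → sum λ l → M k l * M k l - M l k * M k l)
    eq = begin
      (sum λ i → sum λ j → (y i ∙ y j) * (x i ∙ x j) - (y j ∙ x i) * (y i ∙ x j))
        ≈⟨ sum-cong-≋ (λ i → sum-cong-≋ λ j → trans
             (+-cong (sum*sum (λ k → y i k * y j k) (λ l → x i l * x j l))
                     (-‿cong (sum*sum (λ k → y j k * x i k) (λ l → y i l * x j l))))
             (trans (sym (sum-sub (λ k → sum λ l → (y i k * y j k) * (x i l * x j l)) _))
                    (sum-cong-≋ λ k → sym (sum-sub (λ l → (y i k * y j k) * (x i l * x j l)) _)))) ⟩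
      (sum λ i → sum λ j → sum λ k → sum λ l → (y i k * y j k) * (x i l * x j l) - (y j k * x i k) * (y i l * x j l))
        ≈⟨ ∑-comm₄ (λ i j k l → (y i k * y j k) * (x i l * x j l) - (y j k * x i k) * (y i l * x j l)) ⟩
      (sum λ k → sum λ l → sum λ i → sum λ j → (y i k * y j k) * (x i l * x j l) - (y j k * x i k) * (y i l * x j l))
        ≈⟨ sum-cong-≋ (λ k → sum-cong-≋ λ l → trans
             (sum-cong-≋ λ i → trans (sum-cong-≋ λ j →
                  +-cong (solve 4 (λ a b c d → (a :* b) :* (c :* d) := (a :* c) :* (b :* d)) refl (y i k) (y j k) (x i l) (x j l))
                         (-‿cong (solve 4 (λ a b c d → (a :* b) :* (c :* d) := (c :* b) :* (a :* d)) refl (y j k) (x i k) (y i l) (x j l))))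
                (sum-sub (λ j → (y i k * x i l) * (y j k * x j l)) (λ j → (y i l * x i k) * (y j k * x j l))))
             (trans (sum-sub (λ i → sum λ j → (y i k * x i l) * (y j k * x j l)) (λ i → sum λ j → (y i l * x i k) * (y j k * x j l)))
                    (+-cong (sym (sum*sum (λ i → y i k * x i l) (λ j → y j k * x j l))) (-‿cong (sym (sum*sum (λ i → y i l * x i k) (λ j → y j k * x j l))))))) ⟩
      (sum λ k → sum λ l → M k l * M k l - M l k * M k l) ∎

  -- For A the rigidity matrix this yields both the symmetry of L and the expansion of its bilinear
  -- form over the edges.
  ⊛ᵀ-∙ : ∀ {m n} (A : Matrix m n) (x y : Vector Carrier m) → ((A ⊛ (A ᵀ)) · x) ∙ y ≈ ((A ᵀ) · x) ∙ ((A ᵀ) · y)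
  ⊛ᵀ-∙ A x y = begin
    ((A ⊛ (A ᵀ)) · x) ∙ y
      ≈⟨ sum-cong-≋ (λ k → *-congʳ (⊛ᵀ-· A x k)) ⟩
    (sum λ k → (sum λ e → A k e * ((A ᵀ) · x) e) * y k)
      ≈⟨ sum-cong-≋ (λ k → *-distribʳ-sum (y k) (λ e → A k e * ((A ᵀ) · x) e)) ⟩
    (sum λ k → sum λ e → (A k e * ((A ᵀ) · x) e) * y k)
      ≈⟨ ∑-comm (λ k e → (A k e * ((A ᵀ) · x) e) * y k) ⟩
    (sum λ e → sum λ k → (A k e * ((A ᵀ) · x) e) * y k)
      ≈⟨ sum-cong-≋ (λ e → trans
           (sum-cong-≋ λ k → solve 3 (λ a b c → (a :* b) :* c := b :* (a :* c)) refl (A k e) _ (y k))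
           (sym (*-distribˡ-sum (((A ᵀ) · x) e) (λ k → A k e * y k)))) ⟩
    ((A ᵀ) · x) ∙ ((A ᵀ) · y) ∎
    where
    ⊛ᵀ-· : ∀ {m n} (A : Matrix m n) (x : Vector Carrier m) → (A ⊛ (A ᵀ)) · x ≋ A · ((A ᵀ) · x)
    ⊛ᵀ-· A x k = begin
      (sum λ l → (sum λ e → A k e * A l e) * x l)
        ≈⟨ sum-cong-≋ (λ l → *-distribʳ-sum (x l) (λ e → A k e * A l e)) ⟩
      (sum λ l → sum λ e → (A k e * A l e) * x l)
        ≈⟨ ∑-comm (λ l e → (A k e * A l e) * x l) ⟩
      (sum λ e → sum λ l → (A k e * A l e) * x l)
        ≈⟨ sum-cong-≋ (λ e → trans (sum-cong-≋ λ l → *-assoc (A k e) (A l e) (x l)) (sym (*-distribˡ-sum (A k e) (λ l → A l e * x l)))) ⟩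
      (A · ((A ᵀ) · x)) k ∎

-- The quadratic form of the stiffness matrix for centred unit vectors

module CentredUnitVectors {c ℓ} (ℝ : CompleteOrderedField c ℓ) where

  open CompleteOrderedField ℝ
  open EuclideanSpace ℝ
  open Rigidity ℝ
  open OrderedField ℝ
  open Summation ℝ
  open InnerProduct ℝ
  open IntegerCoefficients commutativeRing
  open import Relation.Binary.Reasoning.Setoid setoid

  ⊝≈0⇒≋ : ∀ {n} {x y : Vector Carrier n} → x ⊝ y ≋ 𝟎 → x ≋ y
  ⊝≈0⇒≋ {x = x} {y} x⊝y≋𝟎 i = begin
    x i                ≈⟨ solve 2 (λ x y → x := (x :- y) :+ y) refl (x i) (y i) ⟩
    (x i - y i) + y i  ≈⟨ +-congʳ (x⊝y≋𝟎 i) ⟩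
    0# + y i           ≈⟨ +-identityˡ (y i) ⟩
    y i                ∎

  block : ∀ {n d} → Vector Carrier (n ℕ.* d) → Vector (Vector Carrier d) n
  block x i k = x (Fin.combine i k)

  -- Indexed by `remQuot` exactly as `_⊗_` is, so an `edgeVector` is definitionally the flattening
  -- of its blocks.
  flatten : ∀ {n d} → Vector (Vector Carrier d) n → Vector Carrier (n ℕ.* d)
  flatten {n} {d} X k = uncurry X (Fin.remQuot {n} d k)

  block-flatten : ∀ {n d} (X : Vector (Vector Carrier d) n) i → block (flatten X) i ≋ X i
  block-flatten X i k = reflexive (≡.cong (uncurry X) (Fin.remQuot-combine i k))

  ∙-block : ∀ {n d} (x y : Vector Carrier (n ℕ.* d)) → x ∙ y ≈ sum λ i → block {n} x i ∙ block {n} y i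
  ∙-block {n} x y = sum-combine n (λ k → x k * y k)

  module _ {n d} (p : Vector (Vector Carrier d) n) where

    private

      D : Fin n → Fin n → Vector Carrier d
      D = direction p

      L : Matrix (n ℕ.* d) (n ℕ.* d)
      L = stiffnessMatrix p

    edgeVector-∙ : ∀ i j (x : Vector Carrier (n ℕ.* d)) → edgeVector p (i , j) ∙ x ≈ D i j ∙ (block x i ⊝ block x j)
    edgeVector-∙ i j x = begin
      edgeVector p (i , j) ∙ x
        ≈⟨ ∙-block {n} (edgeVector p (i , j)) x ⟩
      (sum λ a → block {n} (edgeVector p (i , j)) a ∙ block x a)
        ≈⟨ sum-cong-≋ (λ a → trans
             (∙-cong {y = block x a} (block-flatten (λ a → (𝟏 i ⊝ 𝟏 j) a • D i j) a) (λ _ → refl))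
             (∙-•ˡ ((𝟏 i ⊝ 𝟏 j) a) (D i j) (block x a))) ⟩
      (sum λ a → (𝟏 i a - 𝟏 j a) * (D i j ∙ block x a))
        ≈⟨ sum-cong-≋ (λ a → solve 3 (λ a b c → (a :- b) :* c := a :* c :- b :* c) refl (𝟏 i a) (𝟏 j a) (D i j ∙ block x a)) ⟩
      (sum λ a → 𝟏 i a * (D i j ∙ block x a) - 𝟏 j a * (D i j ∙ block x a))
        ≈⟨ sum-sub (λ a → 𝟏 i a * (D i j ∙ block x a)) (λ a → 𝟏 j a * (D i j ∙ block x a)) ⟩
      (sum λ a → 𝟏 i a * (D i j ∙ block x a)) - (sum λ a → 𝟏 j a * (D i j ∙ block x a))
        ≈⟨ +-cong (sum-𝟏ˡ i (λ a → D i j ∙ block x a)) (-‿cong (sum-𝟏ˡ j (λ a → D i j ∙ block x a))) ⟩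
      D i j ∙ block x i - D i j ∙ block x j
        ≈⟨ ∙-⊝ʳ (D i j) (block x i) (block x j) ⟨
      D i j ∙ (block x i ⊝ block x j) ∎

    stiffness-∙ : ∀ (x y : Vector Carrier (n ℕ.* d)) →
      (L · x) ∙ y ≈ sumOver (λ (i , j) → (D i j ∙ (block x i ⊝ block x j)) * (D i j ∙ (block y i ⊝ block y j))) (edges n)
    stiffness-∙ x y = trans (⊛ᵀ-∙ (rigidityMatrix p) x y)
      (sum-cong-≋ λ e → let i , j = List.lookup (edges n) e in *-cong (edgeVector-∙ i j x) (edgeVector-∙ i j y))

    stiffness-symmetric : ∀ (x y : Vector Carrier (n ℕ.* d)) → (L · x) ∙ y ≈ x ∙ (L · y)
    stiffness-symmetric x y = trans (⊛ᵀ-∙ (rigidityMatrix p) x y)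
      (trans (∙-comm ((rigidityMatrix p ᵀ) · x) _)
      (trans (sym (⊛ᵀ-∙ (rigidityMatrix p) y x)) (∙-comm (L · y) x)))

    -- Testing against the residual y = L x - μ x shows that its squared norm vanishes. The factor 2
    -- lets callers work without halves.
    weakEigenvector : ∀ μ (x : Vector Carrier (n ℕ.* d)) →
      (∀ y → 2# * ((L · x) ∙ y) ≈ (2# * μ) * (x ∙ y)) → Eigenspace L μ x
    weakEigenvector μ x weak = ⊝≈0⇒≋ (x∙x≈0⇒x≋𝟎 z (x≉0∧xy≈0⇒y≈0 2≉0 2z∙z≈0))
      where
      z = (L · x) ⊝ (μ • x)
      2z∙z≈0 : 2# * (z ∙ z) ≈ 0#
      2z∙z≈0 = begin
        2# * (z ∙ z)                           ≈⟨ *-congˡ (∙-⊝ˡ (L · x) (μ • x) z) ⟩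
        2# * ((L · x) ∙ z - (μ • x) ∙ z)       ≈⟨ *-congˡ (+-congˡ (-‿cong (∙-•ˡ μ x z))) ⟩
        2# * ((L · x) ∙ z - μ * (x ∙ z))       ≈⟨ solve 3 (λ a b c → con (ℤ.+ 2) :* (a :- b :* c) := con (ℤ.+ 2) :* a :- (con (ℤ.+ 2) :* b) :* c) refl _ μ (x ∙ z) ⟩
        2# * ((L · x) ∙ z) - (2# * μ) * (x ∙ z) ≈⟨ +-congʳ (weak z) ⟩
        (2# * μ) * (x ∙ z) - (2# * μ) * (x ∙ z) ≈⟨ -‿inverseʳ _ ⟩
        0#                                     ∎

    direction-parallel : ∀ i j → ∃[ s ] D i j ≋ s • (p i ⊝ p j)
    direction-parallel i j with p i ≋? p j
    ... | yes _ = 0# , λ k → sym (zeroˡ _)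
    ... | no  _ = _  , λ k → refl

    -- For distinct points δ is the unit vector along q = pᵢ - pⱼ; for coincident points both sides
    -- vanish. Later arguments use only this identity and parallelism, and need no case distinction.
    direction-projects : ∀ i j → (D i j ∙ (p i ⊝ p j)) • D i j ≋ p i ⊝ p j
    direction-projects i j with p i ≋? p j
    ... | yes pᵢ≋pⱼ = λ k → trans (zeroʳ _) (sym (trans (+-congʳ (pᵢ≋pⱼ k)) (-‿inverseʳ _)))
    ... | no  pᵢ≉pⱼ = λ k → begin
      ((ν ⁻¹ • q) ∙ q) * (ν ⁻¹ * q k)        ≈⟨ *-congʳ (trans (∙-•ˡ (ν ⁻¹) q q) (*-congˡ (sym (‖x‖*‖x‖≈x∙x q)))) ⟩
      (ν ⁻¹ * (ν * ν)) * (ν ⁻¹ * q k)        ≈⟨ solve 3 (λ a b c → (a :* (b :* b)) :* (a :* c) := (b :* a) :* (b :* a) :* c) refl (ν ⁻¹) ν (q k) ⟩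
      (ν * ν ⁻¹) * (ν * ν ⁻¹) * q k          ≈⟨ *-congʳ (*-cong (*-inverseʳ ν≉0) (*-inverseʳ ν≉0)) ⟩
      1# * 1# * q k                          ≈⟨ trans (*-congʳ (*-identityˡ 1#)) (*-identityˡ (q k)) ⟩
      q k                                    ∎
      where
      q = p i ⊝ p j
      ν = ‖ q ‖
      ν≉0 : ¬ ν ≈ 0#
      ν≉0 ν≈0 = pᵢ≉pⱼ (⊝≈0⇒≋ (x∙x≈0⇒x≋𝟎 q (trans (sym (‖x‖*‖x‖≈x∙x q)) (trans (*-congʳ ν≈0) (zeroˡ _)))))

    module _ (unit : ∀ i → p i ∙ p i ≈ 1#) where

      module Pair (i j : Fin n) where

        private
          q m δ : Vector Carrier d
          q = p i ⊝ p j
          m = p i ⊞ p j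
          δ = D i j
          s = proj₁ (direction-parallel i j)
          δ≋s•q : δ ≋ s • q
          δ≋s•q = proj₂ (direction-parallel i j)
          γ = p i ∙ p j
          γ-sym : p j ∙ p i ≈ γ
          γ-sym = ∙-comm (p j) (p i)

        q∙x≈[δ∙q][δ∙x] : ∀ x → q ∙ x ≈ (δ ∙ q) * (δ ∙ x)
        q∙x≈[δ∙q][δ∙x] x = trans (∙-cong {y = x} (λ k → sym (direction-projects i j k)) (λ _ → refl)) (∙-•ˡ (δ ∙ q) δ x)

        -- A substitute for δ ∙ δ ≈ 1 that survives coincident points, where δ = 0.
        [δ∙δ][δ∙x]≈δ∙x : ∀ x → (δ ∙ δ) * (δ ∙ x) ≈ δ ∙ x
        [δ∙δ][δ∙x]≈δ∙x x = begin
          (δ ∙ δ) * (δ ∙ x)        ≈⟨ *-congʳ (trans (∙-cong {y = δ} δ≋s•q (λ _ → refl)) (trans (∙-•ˡ s q δ) (*-congˡ (∙-comm q δ)))) ⟩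
          (s * (δ ∙ q)) * (δ ∙ x)  ≈⟨ *-assoc _ _ _ ⟩
          s * ((δ ∙ q) * (δ ∙ x))  ≈⟨ *-congˡ (q∙x≈[δ∙q][δ∙x] x) ⟨
          s * (q ∙ x)              ≈⟨ ∙-•ˡ s q x ⟨
          (s • q) ∙ x              ≈⟨ ∙-cong {y = x} δ≋s•q (λ _ → refl) ⟨
          δ ∙ x                    ∎

        δ∙p : ∀ k → δ ∙ p k ≈ s * (p i ∙ p k - p j ∙ p k)
        δ∙p k = trans (∙-cong {y = p k} δ≋s•q (λ _ → refl))
          (trans (∙-•ˡ s q (p k)) (*-congˡ (∙-⊝ˡ (p i) (p j) (p k))))

        δ∙pᵢ : δ ∙ p i ≈ s * (1# - γ)
        δ∙pᵢ = trans (δ∙p i) (*-congˡ (+-cong (unit i) (-‿cong γ-sym)))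

        δ∙pⱼ : δ ∙ p j ≈ s * (γ - 1#)
        δ∙pⱼ = trans (δ∙p j) (*-congˡ (+-congˡ (-‿cong (unit j))))

        δ∙q : δ ∙ q ≈ s * (1# - γ) - s * (γ - 1#)
        δ∙q = trans (∙-⊝ʳ δ (p i) (p j)) (+-cong δ∙pᵢ (-‿cong δ∙pⱼ))

        -- Twice a pᵢ - b pⱼ equals (a + b) (pᵢ - pⱼ) + (a - b) (pᵢ + pⱼ), and δ is orthogonal to pᵢ
        -- + pⱼ because both points have unit norm.
        2δ∙[apᵢ-bpⱼ] : ∀ a b → 2# * (δ ∙ ((a • p i) ⊝ (b • p j))) ≈ (a + b) * (δ ∙ q)
        2δ∙[apᵢ-bpⱼ] a b = begin
          2# * (δ ∙ ((a • p i) ⊝ (b • p j)))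
            ≈⟨ *-congˡ (trans (∙-⊝ʳ δ (a • p i) (b • p j))
                 (+-cong (trans (∙-•ʳ δ a (p i)) (*-congˡ δ∙pᵢ)) (-‿cong (trans (∙-•ʳ δ b (p j)) (*-congˡ δ∙pⱼ))))) ⟩
          2# * (a * (s * (1# - γ)) - b * (s * (γ - 1#)))
            ≈⟨ solve 4 (λ a b s g → con (ℤ.+ 2) :* (a :* (s :* (con ℤ.1ℤ :- g)) :- b :* (s :* (g :- con ℤ.1ℤ)))
                 := (a :+ b) :* (s :* (con ℤ.1ℤ :- g) :- s :* (g :- con ℤ.1ℤ))) refl a b s γ ⟩
          (a + b) * (s * (1# - γ) - s * (γ - 1#))
            ≈⟨ *-congˡ δ∙q ⟨
          (a + b) * (δ ∙ q) ∎

        -- Bessel's inequality for the orthogonal pair δ, pᵢ + pⱼ.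
        direction-bound : ∀ w → 2# * ((δ ∙ w) * (δ ∙ w)) ≤ (1# + γ) * (w ∙ w) - 2# * ((p i ∙ w) * (p j ∙ w))
        direction-bound w = 0≤y-x⇒x≤y (nonNeg-cancelˡ 0≤2 2≉0 (≤-respʳ eq (x≤y⇒0≤y-x (cauchySchwarz w′ m))))
          where
          e u v : Carrier
          e = δ ∙ w
          u = p i ∙ w
          v = p j ∙ w
          -- The component of w orthogonal to δ. Cauchy-Schwarz for `w′` and `m` is Bessel's
          -- inequality multiplied by `m ∙ m`, which avoids dividing by a norm that is zero for
          -- antipodal points.
          w′ = w ⊝ (e • δ)

          w′∙m : w′ ∙ m ≈ u + v
          w′∙m = begin
            w′ ∙ m                        ≈⟨ ∙-⊝ˡ w (e • δ) m ⟩
            w ∙ m - (e • δ) ∙ m           ≈⟨ +-cong (trans (∙-comm w m) (∙-⊞ˡ (p i) (p j) w))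
                                                    (-‿cong (trans (∙-•ˡ e δ m) (*-congˡ (trans (∙-⊞ʳ δ (p i) (p j)) (+-cong δ∙pᵢ δ∙pⱼ))))) ⟩
            (u + v) - e * (s * (1# - γ) + s * (γ - 1#))
                                          ≈⟨ solve 4 (λ x e s g → x :- e :* (s :* (con ℤ.1ℤ :- g) :+ s :* (g :- con ℤ.1ℤ)) := x) refl (u + v) e s γ ⟩
            u + v                         ∎

          w′∙w′ : w′ ∙ w′ ≈ w ∙ w - e * e
          w′∙w′ = begin
            w′ ∙ w′
              ≈⟨ ∙-⊝ˡ w (e • δ) w′ ⟩
            w ∙ w′ - (e • δ) ∙ w′
              ≈⟨ +-cong (trans (∙-⊝ʳ w w (e • δ)) (+-congˡ (-‿cong (trans (∙-•ʳ w e δ) (*-congˡ (∙-comm w δ))))))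
                        (-‿cong (trans (∙-•ˡ e δ w′) (*-congˡ (trans (∙-⊝ʳ δ w (e • δ))
                          (+-congˡ (-‿cong (trans (∙-•ʳ δ e δ) (trans (*-comm e (δ ∙ δ)) ([δ∙δ][δ∙x]≈δ∙x w))))))))) ⟩
            (w ∙ w - e * e) - e * (e - e)
              ≈⟨ solve 2 (λ x e → (x :- e :* e) :- e :* (e :- e) := x :- e :* e) refl (w ∙ w) e ⟩
            w ∙ w - e * e ∎

          m∙m : m ∙ m ≈ (1# + γ) + (γ + 1#)
          m∙m = trans (∙-⊞ˡ (p i) (p j) m) (+-cong
            (trans (∙-⊞ʳ (p i) (p i) (p j)) (+-congʳ (unit i)))
            (trans (∙-⊞ʳ (p j) (p i) (p j)) (+-cong γ-sym (unit j))))

          q∙q : q ∙ q ≈ (1# - γ) - (γ - 1#)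
          q∙q = trans (∙-⊝ˡ (p i) (p j) q) (+-cong
            (trans (∙-⊝ʳ (p i) (p i) (p j)) (+-congʳ (unit i)))
            (-‿cong (trans (∙-⊝ʳ (p j) (p i) (p j)) (+-cong γ-sym (-‿cong (unit j))))))

          -- This equality is what removes γ from the coefficient of e²: 2 (1 + γ) + 2 (1 - γ) = 4.
          -- It also changes (u + v)² into (u + v)² - (u - v)² = 4 u v.
          e²q∙q : (e * e) * ((1# - γ) - (γ - 1#)) ≈ (u - v) * (u - v)
          e²q∙q = begin
            (e * e) * ((1# - γ) - (γ - 1#))    ≈⟨ *-congˡ q∙q ⟨
            (e * e) * (q ∙ q)                  ≈⟨ *-congˡ (q∙x≈[δ∙q][δ∙x] q) ⟩
            (e * e) * ((δ ∙ q) * (δ ∙ q))      ≈⟨ solve 2 (λ x y → (x :* x) :* (y :* y) := (y :* x) :* (y :* x)) refl e (δ ∙ q) ⟩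
            ((δ ∙ q) * e) * ((δ ∙ q) * e)      ≈⟨ *-cong (q∙x≈[δ∙q][δ∙x] w) (q∙x≈[δ∙q][δ∙x] w) ⟨
            (q ∙ w) * (q ∙ w)                  ≈⟨ *-cong (∙-⊝ˡ (p i) (p j) w) (∙-⊝ˡ (p i) (p j) w) ⟩
            (u - v) * (u - v)                  ∎

          eq : (w′ ∙ w′) * (m ∙ m) - (w′ ∙ m) * (w′ ∙ m)
             ≈ 2# * (((1# + γ) * (w ∙ w) - 2# * (u * v)) - 2# * (e * e))
          eq = begin
            (w′ ∙ w′) * (m ∙ m) - (w′ ∙ m) * (w′ ∙ m)
              ≈⟨ +-cong (*-cong w′∙w′ m∙m) (-‿cong (*-cong w′∙m w′∙m)) ⟩
            (w ∙ w - e * e) * ((1# + γ) + (γ + 1#)) - (u + v) * (u + v)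
              ≈⟨ solve 5 (λ W e g u v →
                   (W :- e :* e) :* ((con ℤ.1ℤ :+ g) :+ (g :+ con ℤ.1ℤ)) :- (u :+ v) :* (u :+ v)
                   := con (ℤ.+ 2) :* (((con ℤ.1ℤ :+ g) :* W :- con (ℤ.+ 2) :* (u :* v)) :- con (ℤ.+ 2) :* (e :* e))
                      :+ ((e :* e) :* ((con ℤ.1ℤ :- g) :- (g :- con ℤ.1ℤ)) :- (u :- v) :* (u :- v))) refl (w ∙ w) e γ u v ⟩
            2# * (((1# + γ) * (w ∙ w) - 2# * (u * v)) - 2# * (e * e)) + ((e * e) * ((1# - γ) - (γ - 1#)) - (u - v) * (u - v))
              ≈⟨ +-congˡ (trans (+-congʳ e²q∙q) (-‿inverseʳ _)) ⟩
            2# * (((1# + γ) * (w ∙ w) - 2# * (u * v)) - 2# * (e * e)) + 0#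
              ≈⟨ +-identityʳ _ ⟩
            2# * (((1# + γ) * (w ∙ w) - 2# * (u * v)) - 2# * (e * e)) ∎

      module _ (centred : ∑ p ≋ 𝟎) where

        ∑p∙x≈0 : ∀ x → (sum λ j → p j ∙ x) ≈ 0#
        ∑p∙x≈0 x = begin
          (sum λ j → p j ∙ x)  ≈⟨ sum-cong-≋ (λ j → ∙-comm (p j) x) ⟩
          (sum λ j → x ∙ p j)  ≈⟨ ∙-∑ʳ x p ⟨
          x ∙ ∑ p              ≈⟨ ∙-cong {x = x} (λ _ → refl) centred ⟩
          x ∙ 𝟎                ≈⟨ sum-cong-≋ (λ k → trans (zeroʳ (x k)) (sym (zeroˡ (x k)))) ⟩
          (sum λ k → 0# * x k) ≈⟨ sum-0*ˡ x ⟩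
          0#                   ∎

        -- This is block i of 2 L applied to the vector with blocks aⱼ pⱼ, paired with y. Of the
        -- four products, only aᵢ ∑ pⱼ is removed by centring.
        radial-row : ∀ (a : Vector Carrier n) i y →
          (sum λ j → (a i + a j) * (p i ∙ y - p j ∙ y))
          ≈ (((fromℕ n * a i + sum a) • p i) ⊝ ∑ (λ j → a j • p j)) ∙ y
        radial-row a i y = begin
          (sum λ j → (a i + a j) * (π i - π j))
            ≈⟨ sum-cong-≋ (λ j → solve 4 (λ a b x y → (a :+ b) :* (x :- y) := ((a :* x :+ b :* x) :- a :* y) :- b :* y) refl (a i) (a j) (π i) (π j)) ⟩
          (sum λ j → ((a i * π i + a j * π i) - a i * π j) - a j * π j)
            ≈⟨ sum-sub (λ j → (a i * π i + a j * π i) - a i * π j) (λ j → a j * π j) ⟩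
          (sum λ j → (a i * π i + a j * π i) - a i * π j) - (sum λ j → a j * π j)
            ≈⟨ +-congʳ (sum-sub (λ j → a i * π i + a j * π i) (λ j → a i * π j)) ⟩
          ((sum λ j → a i * π i + a j * π i) - (sum λ j → a i * π j)) - (sum λ j → a j * π j)
            ≈⟨ +-congʳ (+-cong
                 (trans (∑-distrib-+ (λ j → a i * π i) (λ j → a j * π i)) (+-cong (sum-const n _) (sym (*-distribʳ-sum (π i) a))))
                 (-‿cong (trans (sym (*-distribˡ-sum (a i) π)) (*-congˡ (∑p∙x≈0 y))))) ⟩
          ((fromℕ n * (a i * π i) + sum a * π i) - a i * 0#) - (sum λ j → a j * π j)
            ≈⟨ +-congʳ (solve 4 (λ n a x s → (n :* (a :* x) :+ s :* x) :- a :* con ℤ.0ℤ := (n :* a :+ s) :* x) refl (fromℕ n) (a i) (π i) (sum a)) ⟩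
          (fromℕ n * a i + sum a) * π i - (sum λ j → a j * π j)
            ≈⟨ +-cong (sym (∙-•ˡ (fromℕ n * a i + sum a) (p i) y)) (-‿cong (begin
                 (sum λ j → a j * π j)        ≈⟨ sum-cong-≋ (λ j → trans (sym (∙-•ˡ (a j) (p j) y)) (∙-comm (a j • p j) y)) ⟩
                 (sum λ j → y ∙ (a j • p j))  ≈⟨ ∙-∑ʳ y (λ j → a j • p j) ⟨
                 y ∙ ∑ (λ j → a j • p j)      ≈⟨ ∙-comm y (∑ (λ j → a j • p j)) ⟩
                 ∑ (λ j → a j • p j) ∙ y      ∎)) ⟩
          ((fromℕ n * a i + sum a) • p i) ∙ y - ∑ (λ j → a j • p j) ∙ y
            ≈⟨ ∙-⊝ˡ ((fromℕ n * a i + sum a) • p i) (∑ (λ j → a j • p j)) y ⟨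
          (((fromℕ n * a i + sum a) • p i) ⊝ ∑ (λ j → a j • p j)) ∙ y ∎
          where
          π : Vector Carrier n
          π j = p j ∙ y

        -- Up to a translation, the vectors with blocks aᵢ pᵢ are mapped to vectors of the same kind,
        -- because 2 δᵢⱼ δᵢⱼᵀ (aᵢ pᵢ - aⱼ pⱼ) = (aᵢ + aⱼ) (pᵢ - pⱼ).
        radial-eigenvector : ∀ μ (a : Vector Carrier n) (x : Vector Carrier (n ℕ.* d)) →
          (∀ i j → block x i ⊝ block x j ≋ (a i • p i) ⊝ (a j • p j)) →
          (∀ i → ((fromℕ n * a i + sum a) • p i) ⊝ ∑ (λ j → a j • p j) ≋ (2# * μ) • block x i) →
          Eigenspace L μ x
        radial-eigenvector μ a x differences rows = weakEigenvector μ x λ y →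
          let
            -- The share of an edge that is tested against block i alone. Exchanging i and j gives
            -- the other share, which is the shape `sumOver-edges` expects.
            g : Fin n → Fin n → Carrier
            g i j = (a i + a j) * (p i ∙ block y i - p j ∙ block y i)
            edge : ∀ i j → 2# * ((D i j ∙ (block x i ⊝ block x j)) * (D i j ∙ (block y i ⊝ block y j))) ≈ g i j + g j i
            edge i j = begin
              2# * ((D i j ∙ (block x i ⊝ block x j)) * (D i j ∙ (block y i ⊝ block y j)))
                ≈⟨ *-assoc _ _ _ ⟨
              (2# * (D i j ∙ (block x i ⊝ block x j))) * (D i j ∙ (block y i ⊝ block y j))
                ≈⟨ *-congʳ (trans (*-congˡ (∙-cong {x = D i j} (λ _ → refl) (differences i j))) (Pair.2δ∙[apᵢ-bpⱼ] i j (a i) (a j))) ⟩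
              ((a i + a j) * (D i j ∙ (p i ⊝ p j))) * (D i j ∙ (block y i ⊝ block y j))
                ≈⟨ *-assoc _ _ _ ⟩
              (a i + a j) * ((D i j ∙ (p i ⊝ p j)) * (D i j ∙ (block y i ⊝ block y j)))
                ≈⟨ *-congˡ (Pair.q∙x≈[δ∙q][δ∙x] i j (block y i ⊝ block y j)) ⟨
              (a i + a j) * ((p i ⊝ p j) ∙ (block y i ⊝ block y j))
                ≈⟨ *-congˡ (trans (∙-⊝ʳ (p i ⊝ p j) (block y i) (block y j))
                     (+-cong (∙-⊝ˡ (p i) (p j) (block y i)) (-‿cong (∙-⊝ˡ (p i) (p j) (block y j))))) ⟩
              (a i + a j) * ((p i ∙ block y i - p j ∙ block y i) - (p i ∙ block y j - p j ∙ block y j))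
                ≈⟨ solve 6 (λ a b r s t u → (a :+ b) :* ((r :- s) :- (t :- u)) := (a :+ b) :* (r :- s) :+ (b :+ a) :* (u :- t))
                     refl (a i) (a j) _ _ _ _ ⟩
              g i j + g j i ∎
          in begin
          2# * ((L · x) ∙ y)
            ≈⟨ *-congˡ (stiffness-∙ x y) ⟩
          2# * sumOver (λ (i , j) → (D i j ∙ (block x i ⊝ block x j)) * (D i j ∙ (block y i ⊝ block y j))) (edges n)
            ≈⟨ *-distribˡ-sumOver 2# (λ (i , j) → (D i j ∙ (block x i ⊝ block x j)) * (D i j ∙ (block y i ⊝ block y j))) (edges n) ⟩
          sumOver (λ (i , j) → 2# * ((D i j ∙ (block x i ⊝ block x j)) * (D i j ∙ (block y i ⊝ block y j)))) (edges n)
            ≈⟨ sum-cong-≋ (λ e → let i , j = List.lookup (edges n) e in edge i j) ⟩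
          sumOver (λ (i , j) → g i j + g j i) (edges n)
            ≈⟨ sumOver-edges g (λ i → trans (*-congˡ (-‿inverseʳ _)) (zeroʳ _)) ⟩
          (sum λ i → sum λ j → g i j)
            ≈⟨ sum-cong-≋ (λ i → trans (radial-row a i (block y i))
                 (trans (∙-cong {y = block y i} (rows i) (λ _ → refl)) (∙-•ˡ (2# * μ) (block {n} x i) (block y i)))) ⟩
          (sum λ i → (2# * μ) * (block {n} x i ∙ block y i))
            ≈⟨ *-distribˡ-sum (2# * μ) (λ i → block {n} x i ∙ block y i) ⟨
          (2# * μ) * (sum λ i → block {n} x i ∙ block y i)
            ≈⟨ *-congˡ (∙-block {n} x y) ⟨
          (2# * μ) * (x ∙ y) ∎

        -- Orthogonality to `flatten p` is exactly ∑ pᵢ ∙ xᵢ = 0, which removes the only correction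
        -- that could raise the bound. The remaining corrections, ‖∑ xᵢ‖² and the bivector norm,
        -- enter with a minus sign.
        stiffness-bound : ∀ x → flatten p ∙ x ≈ 0# → 2# * ((L · x) ∙ x) ≤ fromℕ n * (x ∙ x)
        stiffness-bound x p∙x≈0 = ≤.trans edges-bound (0≤y-x⇒x≤y
          (≤-respʳ total (+-nonNeg (x∙x-nonNeg (∑ X)) (wedge-nonNeg X p))))
          where
          X = block x
          A a : Vector Carrier n
          A i = X i ∙ X i
          a i = p i ∙ X i
          α τ γ W f : Fin n → Fin n → Carrier
          α i j = p j ∙ X i
          τ i j = X i ∙ X j
          γ i j = p i ∙ p j
          W i j = γ i j * τ i j - α i j * α j i
          -- One ordered-pair share of the edge bound. It is arranged so that, for fixed i, the
          -- terms with γ i j * `A i` and `α i j` are linear in p j and sum to zero over j, while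
          -- `W` collects the terms of `wedge-nonNeg`.
          f i j = ((((A i + γ i j * A i) - 2# * (a i * α i j)) + a i * a j) - τ i j) - W i j

          f-sym : ∀ i j → (1# + γ i j) * ((X i ⊝ X j) ∙ (X i ⊝ X j)) - 2# * ((p i ∙ (X i ⊝ X j)) * (p j ∙ (X i ⊝ X j)))
                          ≈ f i j + f j i
          f-sym i j = begin
            (1# + γ i j) * ((X i ⊝ X j) ∙ (X i ⊝ X j)) - 2# * ((p i ∙ (X i ⊝ X j)) * (p j ∙ (X i ⊝ X j)))
              ≈⟨ +-cong (*-congˡ (trans (∙-⊝ˡ (X i) (X j) (X i ⊝ X j))
                          (+-cong (∙-⊝ʳ (X i) (X i) (X j)) (-‿cong (trans (∙-⊝ʳ (X j) (X i) (X j)) (+-congʳ (∙-comm (X j) (X i))))))))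
                        (-‿cong (*-congˡ (*-cong (∙-⊝ʳ (p i) (X i) (X j)) (∙-⊝ʳ (p j) (X i) (X j))))) ⟩
            (1# + γ i j) * ((A i - τ i j) - (τ i j - A j)) - 2# * ((a i - α j i) * (α i j - a j))
              ≈⟨ solve 8 (λ g A B t a b r s →
                   (con ℤ.1ℤ :+ g) :* ((A :- t) :- (t :- B)) :- con (ℤ.+ 2) :* ((a :- s) :* (r :- b))
                   := (((((A :+ g :* A) :- con (ℤ.+ 2) :* (a :* r)) :+ a :* b) :- t) :- (g :* t :- r :* s))
                   :+ (((((B :+ g :* B) :- con (ℤ.+ 2) :* (b :* s)) :+ b :* a) :- t) :- (g :* t :- s :* r)))
                   refl (γ i j) (A i) (A j) (τ i j) (a i) (a j) (α i j) (α j i) ⟩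
            f i j + (((((A j + γ i j * A j) - 2# * (a j * α j i)) + a j * a i) - τ i j) - (γ i j * τ i j - α j i * α i j))
              ≈⟨ +-congˡ (+-cong (+-cong (+-congʳ (+-congʳ (+-congˡ (*-congʳ γ-comm)))) (-‿cong τ-comm))
                                 (-‿cong (+-congʳ (*-cong γ-comm τ-comm)))) ⟩
            f i j + f j i ∎
            where
            γ-comm : γ i j ≈ γ j i
            γ-comm = ∙-comm (p i) (p j)
            τ-comm : τ i j ≈ τ j i
            τ-comm = ∙-comm (X i) (X j)

          -- On the diagonal γ i i = 1 by `unit`, and the terms cancel; this licenses the passage
          -- from edges to all ordered pairs.
          fᵢᵢ≈0 : ∀ i → f i i ≈ 0#
          fᵢᵢ≈0 i = begin
            f i i
              ≈⟨ +-cong (+-congʳ (+-congʳ (+-congʳ (+-congˡ (*-congʳ (unit i)))))) (-‿cong (+-congʳ (*-congʳ (unit i)))) ⟩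
            ((((A i + 1# * A i) - 2# * (a i * a i)) + a i * a i) - A i) - (1# * A i - a i * a i)
              ≈⟨ solve 2 (λ A a → ((((A :+ con ℤ.1ℤ :* A) :- con (ℤ.+ 2) :* (a :* a)) :+ a :* a) :- A) :- (con ℤ.1ℤ :* A :- a :* a)
                   := con ℤ.0ℤ) refl (A i) (a i) ⟩
            0# ∎

          edges-bound : 2# * ((L · x) ∙ x) ≤ sum λ i → sum λ j → f i j
          edges-bound = ≤-respˡ (sym (trans (*-congˡ (stiffness-∙ x x)) (*-distribˡ-sumOver 2# (λ (i , j) → (D i j ∙ (X i ⊝ X j)) * (D i j ∙ (X i ⊝ X j))) (edges n))))
            (≤-respʳ (sumOver-edges f fᵢᵢ≈0) (sum-mono-≤ λ e → let i , j = List.lookup (edges n) e in edge-bound i j))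
            where
            edge-bound : ∀ i j → 2# * ((D i j ∙ (X i ⊝ X j)) * (D i j ∙ (X i ⊝ X j))) ≤ f i j + f j i
            edge-bound i j = ≤-respʳ (f-sym i j) (Pair.direction-bound i j (X i ⊝ X j))

          row : ∀ i → (sum λ j → f i j) ≈ ((fromℕ n * A i + a i * sum a) - X i ∙ ∑ X) - sum (W i)
          row i = begin
            (sum λ j → f i j)
              ≈⟨ sum-sub (λ j → (((A i + γ i j * A i) - 2# * (a i * α i j)) + a i * a j) - τ i j) (W i) ⟩
            (sum λ j → (((A i + γ i j * A i) - 2# * (a i * α i j)) + a i * a j) - τ i j) - sum (W i)
              ≈⟨ +-congʳ (trans (sum-sub (λ j → ((A i + γ i j * A i) - 2# * (a i * α i j)) + a i * a j) (τ i))
                   (+-cong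
                     (trans (∑-distrib-+ (λ j → (A i + γ i j * A i) - 2# * (a i * α i j)) (λ j → a i * a j))
                       (+-cong
                         (trans (sum-sub (λ j → A i + γ i j * A i) (λ j → 2# * (a i * α i j)))
                           (+-cong
                             (trans (∑-distrib-+ (λ j → A i) (λ j → γ i j * A i))
                               (+-cong (sum-const n (A i))
                                 (trans (sym (*-distribʳ-sum (A i) (γ i)))
                                   (*-congʳ (trans (sum-cong-≋ λ j → ∙-comm (p i) (p j)) (∑p∙x≈0 (p i)))))))
                             (-‿cong (trans (sym (*-distribˡ-sum 2# (λ j → a i * α i j)))
                               (*-congˡ (trans (sym (*-distribˡ-sum (a i) (α i))) (*-congˡ (∑p∙x≈0 (X i)))))))))
                         (sym (*-distribˡ-sum (a i) a))))
                     (-‿cong (sym (∙-∑ʳ (X i) X))))) ⟩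
            ((((fromℕ n * A i + 0# * A i) - 2# * (a i * 0#)) + a i * sum a) - X i ∙ ∑ X) - sum (W i)
              ≈⟨ +-congʳ (+-congʳ (+-congʳ (solve 3 (λ n A a → (n :* A :+ con ℤ.0ℤ :* A) :- con (ℤ.+ 2) :* (a :* con ℤ.0ℤ) := n :* A) refl (fromℕ n) (A i) (a i)))) ⟩
            ((fromℕ n * A i + a i * sum a) - X i ∙ ∑ X) - sum (W i) ∎

          sum-a≈0 : sum a ≈ 0#
          sum-a≈0 = begin
            (sum λ i → p i ∙ X i)                        ≈⟨ sum-cong-≋ (λ i → ∙-cong {y = X i} (block-flatten p i) (λ _ → refl)) ⟨
            (sum λ i → block {n} (flatten p) i ∙ X i)    ≈⟨ ∙-block {n} (flatten p) x ⟨
            flatten p ∙ x                                ≈⟨ p∙x≈0 ⟩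
            0#                                           ∎

          rows : (sum λ i → sum λ j → f i j) ≈ (fromℕ n * (x ∙ x) - ∑ X ∙ ∑ X) - (sum λ i → sum (W i))
          rows = begin
            (sum λ i → sum λ j → f i j)
              ≈⟨ sum-cong-≋ row ⟩
            (sum λ i → ((fromℕ n * A i + a i * sum a) - X i ∙ ∑ X) - sum (W i))
              ≈⟨ sum-sub (λ i → (fromℕ n * A i + a i * sum a) - X i ∙ ∑ X) (λ i → sum (W i)) ⟩
            (sum λ i → (fromℕ n * A i + a i * sum a) - X i ∙ ∑ X) - (sum λ i → sum (W i))
              ≈⟨ +-congʳ (sum-sub (λ i → fromℕ n * A i + a i * sum a) (λ i → X i ∙ ∑ X)) ⟩
            ((sum λ i → fromℕ n * A i + a i * sum a) - (sum λ i → X i ∙ ∑ X)) - (sum λ i → sum (W i))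
              ≈⟨ +-congʳ (+-cong
                   (trans (∑-distrib-+ (λ i → fromℕ n * A i) (λ i → a i * sum a)) (+-cong
                     (trans (sym (*-distribˡ-sum (fromℕ n) A)) (*-congˡ (sym (∙-block {n} x x))))
                     (trans (sym (*-distribʳ-sum (sum a) a)) (trans (*-congʳ sum-a≈0) (zeroˡ _)))))
                   (-‿cong (trans (sum-cong-≋ λ i → ∙-comm (X i) (∑ X)) (sym (∙-∑ʳ (∑ X) X))))) ⟩
            ((fromℕ n * (x ∙ x) + 0#) - ∑ X ∙ ∑ X) - (sum λ i → sum (W i))
              ≈⟨ +-congʳ (+-congʳ (+-identityʳ _)) ⟩
            (fromℕ n * (x ∙ x) - ∑ X ∙ ∑ X) - (sum λ i → sum (W i)) ∎

          total : ∑ X ∙ ∑ X + (sum λ i → sum (W i)) ≈ fromℕ n * (x ∙ x) - (sum λ i → sum λ j → f i j)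
          total = begin
            ∑ X ∙ ∑ X + (sum λ i → sum (W i))
              ≈⟨ solve 3 (λ n s w → s :+ w := n :- ((n :- s) :- w)) refl (fromℕ n * (x ∙ x)) (∑ X ∙ ∑ X) _ ⟩
            fromℕ n * (x ∙ x) - ((fromℕ n * (x ∙ x) - ∑ X ∙ ∑ X) - (sum λ i → sum (W i)))
              ≈⟨ +-congˡ (-‿cong rows) ⟨
            fromℕ n * (x ∙ x) - (sum λ i → sum λ j → f i j) ∎

-- Eigenvalue lists and multiplicities

module EigenvalueLists {c ℓ} (ℝ : CompleteOrderedField c ℓ) where

  open CompleteOrderedField ℝ
  open EuclideanSpace ℝ
  open OrderedField ℝ
  open Summation ℝ
  open IntegerCoefficients commutativeRing
  open import Relation.Binary.Reasoning.Setoid setoid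

  𝟏-diagonal : ∀ {n} (i : Fin n) → 𝟏 i i ≈ 1#
  𝟏-diagonal i rewrite dec-true (i Fin.≟ i) ≡.refl = refl

  𝟏-offDiagonal : ∀ {n} {i j : Fin n} → ¬ i ≡ j → 𝟏 i j ≈ 0#
  𝟏-offDiagonal {i = i} {j} i≢j rewrite dec-false (i Fin.≟ j) i≢j = refl

  module _ {m n p} {V : Vector Carrier n → Set p} {b : Vector (Vector Carrier n) m} (isBasis : IsBasis V b) where

    open IsBasis isBasis

    basis-nonzero : ∀ i → ¬ b i ≋ 𝟎
    basis-nonzero i bᵢ≋𝟎 = 0≉1 (trans (sym (independent (𝟏 i) combination i)) (𝟏-diagonal i))
      where
      combination : ∑ (λ k → 𝟏 i k • b k) ≋ 𝟎
      combination l = trans (sum-𝟏ˡ i (λ k → b k l)) (bᵢ≋𝟎 l)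

    -- Otherwise t bᵢ - s bⱼ = 0 is a relation whose coefficient at i is t, so t = 0 and bⱼ would be
    -- zero.
    basis-notCollinear : ∀ {i j s t z} → ¬ i ≡ j → b i ≋ s • z → ¬ b j ≋ t • z
    basis-notCollinear {i} {j} {s} {t} {z} i≢j bᵢ≋sz bⱼ≋tz =
      basis-nonzero j λ l → trans (bⱼ≋tz l) (trans (*-congʳ t≈0) (zeroˡ _))
      where
      a : Vector Carrier m
      a k = t * 𝟏 i k - s * 𝟏 j k
      combination : ∑ (λ k → a k • b k) ≋ 𝟎
      combination l = begin
        (sum λ k → (t * 𝟏 i k - s * 𝟏 j k) * b k l)
          ≈⟨ sum-cong-≋ (λ k → solve 5 (λ t x s y b → (t :* x :- s :* y) :* b := t :* (x :* b) :- s :* (y :* b)) refl t (𝟏 i k) s (𝟏 j k) (b k l)) ⟩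
        (sum λ k → t * (𝟏 i k * b k l) - s * (𝟏 j k * b k l))
          ≈⟨ sum-sub (λ k → t * (𝟏 i k * b k l)) (λ k → s * (𝟏 j k * b k l)) ⟩
        (sum λ k → t * (𝟏 i k * b k l)) - (sum λ k → s * (𝟏 j k * b k l))
          ≈⟨ +-cong (trans (sym (*-distribˡ-sum t (λ k → 𝟏 i k * b k l))) (*-congˡ (trans (sum-𝟏ˡ i (λ k → b k l)) (bᵢ≋sz l))))
                    (-‿cong (trans (sym (*-distribˡ-sum s (λ k → 𝟏 j k * b k l))) (*-congˡ (trans (sum-𝟏ˡ j (λ k → b k l)) (bⱼ≋tz l))))) ⟩
        t * (s * z l) - s * (t * z l)
          ≈⟨ solve 3 (λ s t z → t :* (s :* z) :- s :* (t :* z) := con ℤ.0ℤ) refl s t (z l) ⟩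
        0# ∎
      t≈0 : t ≈ 0#
      t≈0 = begin
        t                        ≈⟨ solve 2 (λ s t → t := t :* con ℤ.1ℤ :- s :* con ℤ.0ℤ) refl s t ⟩
        t * 1# - s * 0#          ≈⟨ +-cong (*-congˡ (𝟏-diagonal i)) (-‿cong (*-congˡ (𝟏-offDiagonal (λ j≡i → i≢j (≡.sym j≡i))))) ⟨
        t * 𝟏 i i - s * 𝟏 j i    ≈⟨ independent a combination i ⟩
        0#                       ∎

  occurrence : ∀ {n} μ (v : Vector Carrier n) k → v k ≈ μ → Fin (occurrences μ v)
  occurrence μ v k vₖ≈μ = Any.index (∈-filter⁺ (λ k → v k ≟ μ) (∈-allFin k) vₖ≈μ)

  occurrence-injective : ∀ {n} μ (v : Vector Carrier n) k l (vₖ≈μ : v k ≈ μ) (vₗ≈μ : v l ≈ μ) →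
                         occurrence μ v k vₖ≈μ ≡ occurrence μ v l vₗ≈μ → k ≡ l
  occurrence-injective {n} μ v k l vₖ≈μ vₗ≈μ eq = ≡.trans (lookup-index (member k vₖ≈μ))
    (≡.trans (≡.cong (List.lookup (List.filter (λ k → v k ≟ μ) (List.allFin n))) eq) (≡.sym (lookup-index (member l vₗ≈μ))))
    where
    member : ∀ k → v k ≈ μ → k ∈ List.filter (λ k → v k ≟ μ) (List.allFin n)
    member k = ∈-filter⁺ (λ k → v k ≟ μ) (∈-allFin k)

  module _ {n} {A : Matrix n n} {v : Vector Carrier n} (isList : IsEigenvalueList A v) where

    open IsEigenvalueList isList

    entry-eigenvector : ∀ k → ∃[ x ] Eigenspace A (v k) x × ¬ x ≋ 𝟎
    entry-eigenvector k with b , isBasis ← multiplicity (v k) =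
      let e = occurrence (v k) v k refl in b e , IsBasis.member isBasis e , basis-nonzero isBasis e

    -- Were μ absent from the list, its eigenspace would have a basis without members, and x would
    -- be an empty combination.
    eigenvalue-occurs : ∀ {μ x} → Eigenspace A μ x → ¬ x ≋ 𝟎 → ∃[ k ] v k ≈ μ
    eigenvalue-occurs {μ} {x} Ax≋μx x≉𝟎 with Fin.any? (λ k → v k ≟ μ)
    ... | yes occurs = occurs
    ... | no  absent with b , isBasis ← multiplicity μ with a , x≋∑ ← IsBasis.spanning isBasis x Ax≋μx =
      contradiction (λ l → trans (x≋∑ l) (trans (sum-cong-≋ {y = λ _ → 0#} (λ e → contradiction (found e) absent))
                                                (sum-replicate-zero (occurrences μ v)))) x≉𝟎
      where
      found : Fin (occurrences μ v) → ∃[ k ] v k ≈ μ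
      found e = _ , proj₂ (∈-filter⁻ (λ k → v k ≟ μ) {xs = List.allFin n} (∈-lookup e))

    -- Two positions carrying μ provide two different members of a basis of the eigenspace, both
    -- multiples of z.
    simple-eigenvalue-occursOnce : ∀ {μ z} → (∀ x → Eigenspace A μ x → ∃[ s ] x ≋ s • z) →
                                   ∀ {k l} → v k ≈ μ → v l ≈ μ → k ≡ l
    simple-eigenvalue-occursOnce {μ} {z} simple {k} {l} vₖ≈μ vₗ≈μ with k Fin.≟ l
    ... | yes k≡l = k≡l
    ... | no  k≢l with b , isBasis ← multiplicity μ =
      let i = occurrence μ v k vₖ≈μ
          j = occurrence μ v l vₗ≈μ
      in contradiction (proj₂ (simple (b j) (IsBasis.member isBasis j)))
           (basis-notCollinear isBasis {z = z} (λ i≡j → k≢l (occurrence-injective μ v k l vₖ≈μ vₗ≈μ i≡j))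
             (proj₂ (simple (b i) (IsBasis.member isBasis i))))

  -- Identifies the entry without knowing the rest of the spectrum. The first entry is μ, since μ
  -- occurs and all other eigenvalues are at most ν. The next one is not μ by simplicity, hence at
  -- most ν; it is at least ν because ν occurs at a nonzero position.
  secondEntry : ∀ {n} {A : Matrix n n} {v : Vector Carrier n} {μ ν x y} → IsEigenvalueList A v →
    Eigenspace A μ x → ¬ x ≋ 𝟎 → (∀ z → Eigenspace A μ z → ∃[ s ] z ≋ s • x) →
    Eigenspace A ν y → ¬ y ≋ 𝟎 →
    ¬ μ ≤ ν → (∀ κ z → Eigenspace A κ z → ¬ z ≋ 𝟎 → κ ≈ μ ⊎ κ ≤ ν) →
    ∃[ k ] toℕ k ≡ 1 × v k ≈ ν
  secondEntry {n} {A} {v} {μ} {ν} isList Ax≋μx x≉𝟎 simple Ay≋νy y≉𝟎 μ≰ν dichotomy =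
    second nonincreasing entry occursOnce (eigenvalue-occurs isList Ax≋μx x≉𝟎) (eigenvalue-occurs isList Ay≋νy y≉𝟎)
    where
    open IsEigenvalueList isList using (nonincreasing)
    entry : ∀ k → v k ≈ μ ⊎ v k ≤ ν
    entry k = let z , Az≋vₖz , z≉𝟎 = entry-eigenvector isList k in dichotomy (v k) z Az≋vₖz z≉𝟎
    occursOnce : ∀ k l → v k ≈ μ → v l ≈ μ → k ≡ l
    occursOnce k l = simple-eigenvalue-occursOnce isList simple
    second : ∀ {n} {v : Vector Carrier n} → (∀ {i j} → i Fin.≤ j → v j ≤ v i) → (∀ k → v k ≈ μ ⊎ v k ≤ ν) →
      (∀ k l → v k ≈ μ → v l ≈ μ → k ≡ l) → ∃[ k ] v k ≈ μ → ∃[ k ] v k ≈ ν → ∃[ k ] toℕ k ≡ 1 × v k ≈ ν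
    second {suc n} {v} decreasing entry once (k , vₖ≈μ) (l , vₗ≈ν) = locate l vₗ≈ν
      where
      v₀≈μ : v Fin.zero ≈ μ
      v₀≈μ with entry Fin.zero
      ... | inj₁ v₀≈μ = v₀≈μ
      ... | inj₂ v₀≤ν = contradiction (≤-respˡ vₖ≈μ (≤.trans (decreasing ℕ.z≤n) v₀≤ν)) μ≰ν
      locate : ∀ l → v l ≈ ν → ∃[ k ] toℕ k ≡ 1 × v k ≈ ν
      locate Fin.zero              v₀≈ν = contradiction (≤.reflexive (trans (sym v₀≈μ) v₀≈ν)) μ≰ν
      -- A nonzero position carrying ν forces at least two entries, so position 1 exists; the
      -- pattern `suc _` exposes this.
      locate (Fin.suc {suc _} l) vₗ≈ν with entry (Fin.suc Fin.zero)
      ... | inj₁ v₁≈μ with () ← once Fin.zero (Fin.suc Fin.zero) v₀≈μ v₁≈μ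
      ... | inj₂ v₁≤ν = Fin.suc Fin.zero , ≡.refl ,
        ≤.antisym v₁≤ν (≤-respˡ vₗ≈ν (decreasing {Fin.suc Fin.zero} {Fin.suc l} (ℕ.s≤s ℕ.z≤n)))

-- The two largest eigenvalues of the stiffness matrix

module StiffnessSpectrum {c ℓ} (ℝ : CompleteOrderedField c ℓ) where

  open CompleteOrderedField ℝ
  open EuclideanSpace ℝ
  open Rigidity ℝ
  open OrderedField ℝ
  open Summation ℝ
  open InnerProduct ℝ
  open CentredUnitVectors ℝ
  open EigenvalueLists ℝ
  open IntegerCoefficients commutativeRing
  open import Relation.Binary.Reasoning.Setoid setoid

  ‖x‖≈1⇒x∙x≈1 : ∀ {n} (x : Vector Carrier n) → ‖ x ‖ ≈ 1# → x ∙ x ≈ 1#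
  ‖x‖≈1⇒x∙x≈1 x ‖x‖≈1 = trans (sym (‖x‖*‖x‖≈x∙x x)) (trans (*-cong ‖x‖≈1 ‖x‖≈1) (*-identityˡ 1#))

  module _ {n d} (p : Vector (Vector Carrier d) n) (unit : ∀ i → p i ∙ p i ≈ 1#) (centred : ∑ p ≋ 𝟎)
           (n≉0 : ¬ fromℕ n ≈ 0#) where

    private

      L : Matrix (n ℕ.* d) (n ℕ.* d)
      L = stiffnessMatrix p

      P : Vector Carrier (n ℕ.* d)
      P = flatten p

      h : Carrier
      h = fromℕ n * 2# ⁻¹

      2h≈n : 2# * h ≈ fromℕ n
      2h≈n = begin
        2# * (fromℕ n * 2# ⁻¹)  ≈⟨ solve 3 (λ a b c → a :* (b :* c) := b :* (a :* c)) refl 2# (fromℕ n) (2# ⁻¹) ⟩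
        fromℕ n * (2# * 2# ⁻¹)  ≈⟨ *-congˡ (*-inverseʳ 2≉0) ⟩
        fromℕ n * 1#            ≈⟨ *-identityʳ _ ⟩
        fromℕ n                 ∎

      sum-1≈n : sum {n} (λ _ → 1#) ≈ fromℕ n
      sum-1≈n = trans (sum-const n 1#) (*-identityʳ _)

    P∙P≈n : P ∙ P ≈ fromℕ n
    P∙P≈n = begin
      P ∙ P                                  ≈⟨ ∙-block {n} P P ⟩
      (sum λ i → block {n} P i ∙ block P i)  ≈⟨ sum-cong-≋ (λ i → trans (∙-cong (block-flatten p i) (block-flatten p i)) (unit i)) ⟩
      sum {n} (λ _ → 1#)                     ≈⟨ sum-1≈n ⟩
      fromℕ n                                ∎

    P≉𝟎 : ¬ P ≋ 𝟎
    P≉𝟎 P≋𝟎 = n≉0 (begin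
      fromℕ n              ≈⟨ P∙P≈n ⟨
      P ∙ P                ≈⟨ ∙-cong {y = P} P≋𝟎 (λ _ → refl) ⟩
      𝟎 ∙ P                ≈⟨ sum-0*ˡ P ⟩
      0#                   ∎)

    -- Constant weights 1 in the radial formula: n + ∑ 1 = 2 n, and the translation term is ∑ pⱼ =
    -- 0.
    P-eigenvector : Eigenspace L (fromℕ n) P
    P-eigenvector = radial-eigenvector p unit centred (fromℕ n) (λ _ → 1#) P
      (λ i j k → +-cong (block1 i k) (-‿cong (block1 j k)))
      (λ i k → begin
        (fromℕ n * 1# + sum {n} (λ _ → 1#)) * p i k - (sum λ j → 1# * p j k)
          ≈⟨ +-cong (*-congʳ (+-congˡ sum-1≈n)) (-‿cong (trans (sum-cong-≋ λ j → *-identityˡ (p j k)) (centred k))) ⟩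
        (fromℕ n * 1# + fromℕ n) * p i k - 0#
          ≈⟨ solve 2 (λ n x → (n :* con ℤ.1ℤ :+ n) :* x :- con ℤ.0ℤ := (con (ℤ.+ 2) :* n) :* x) refl (fromℕ n) (p i k) ⟩
        (2# * fromℕ n) * p i k
          ≈⟨ *-congˡ (block-flatten p i k) ⟨
        (2# * fromℕ n) * block {n} P i k ∎)
      where
      block1 : ∀ i k → block {n} P i k ≈ 1# * p i k
      block1 i k = trans (block-flatten p i k) (sym (*-identityˡ (p i k)))

    n≰h : ¬ fromℕ n ≤ h
    n≰h n≤h = n≉0 (≤.antisym (0≤-x⇒x≤0 (≤-respʳ eq (*-nonNeg 0≤2 (x≤y⇒0≤y-x n≤h)))) (0≤fromℕ n))
      where
      eq : 2# * (h - fromℕ n) ≈ - fromℕ n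
      eq = begin
        2# * (h - fromℕ n)        ≈⟨ solve 2 (λ h n → con (ℤ.+ 2) :* (h :- n) := con (ℤ.+ 2) :* h :- con (ℤ.+ 2) :* n) refl h (fromℕ n) ⟩
        2# * h - 2# * fromℕ n     ≈⟨ +-congʳ 2h≈n ⟩
        fromℕ n - 2# * fromℕ n    ≈⟨ solve 1 (λ n → n :- con (ℤ.+ 2) :* n := :- n) refl (fromℕ n) ⟩
        - fromℕ n                 ∎

    -- The Rayleigh quotient: on an eigenvector `stiffness-bound` reads 2 μ ‖x‖² ≤ n ‖x‖², and ‖x‖²
    -- can be cancelled.
    orthogonal-eigenvalue : ∀ {μ x} → Eigenspace L μ x → P ∙ x ≈ 0# → ¬ x ≋ 𝟎 → μ ≤ h
    orthogonal-eigenvalue {μ} {x} Lx≋μx P∙x≈0 x≉𝟎 =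
      0≤y-x⇒x≤y (nonNeg-cancelˡ 0≤2 2≉0 (nonNeg-cancelˡ (x∙x-nonNeg x) (λ x∙x≈0 → x≉𝟎 (x∙x≈0⇒x≋𝟎 x x∙x≈0))
        (≤-respʳ eq (x≤y⇒0≤y-x (stiffness-bound p unit centred x P∙x≈0)))))
      where
      eq : fromℕ n * (x ∙ x) - 2# * ((L · x) ∙ x) ≈ (x ∙ x) * (2# * (h - μ))
      eq = begin
        fromℕ n * (x ∙ x) - 2# * ((L · x) ∙ x)
          ≈⟨ +-cong (*-congʳ (sym 2h≈n)) (-‿cong (*-congˡ (trans (∙-cong {y = x} Lx≋μx (λ _ → refl)) (∙-•ˡ μ x x)))) ⟩
        (2# * h) * (x ∙ x) - 2# * (μ * (x ∙ x))
          ≈⟨ solve 3 (λ h m x → (con (ℤ.+ 2) :* h) :* x :- con (ℤ.+ 2) :* (m :* x) := x :* (con (ℤ.+ 2) :* (h :- m))) refl h μ (x ∙ x) ⟩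
        (x ∙ x) * (2# * (h - μ)) ∎

    -- Subtract the projection onto P, whose coefficient is (P ∙ x) / n because P ∙ P = n. A nonzero
    -- remainder would be an eigenvector for n orthogonal to P, forcing n ≤ n / 2.
    n-simple : ∀ x → Eigenspace L (fromℕ n) x → ∃[ s ] x ≋ s • P
    n-simple x Lx≋nx with (x ⊝ ((P ∙ x) * fromℕ n ⁻¹) • P) ≋? 𝟎
    ... | yes y≋𝟎 = _ , ⊝≈0⇒≋ y≋𝟎
    ... | no  y≉𝟎 = contradiction (orthogonal-eigenvalue Ly≋ny P∙y≈0 y≉𝟎) n≰h
      where
      s = (P ∙ x) * fromℕ n ⁻¹
      y = x ⊝ s • P
      Ly≋ny : Eigenspace L (fromℕ n) y
      Ly≋ny k = begin
        L k ∙ (x ⊝ s • P)                       ≈⟨ trans (∙-⊝ʳ (L k) x (s • P)) (+-congˡ (-‿cong (∙-•ʳ (L k) s P))) ⟩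
        L k ∙ x - s * (L k ∙ P)                 ≈⟨ +-cong (Lx≋nx k) (-‿cong (*-congˡ (P-eigenvector k))) ⟩
        fromℕ n * x k - s * (fromℕ n * P k)     ≈⟨ solve 4 (λ n x s p → n :* x :- s :* (n :* p) := n :* (x :- s :* p)) refl (fromℕ n) (x k) s (P k) ⟩
        fromℕ n * (x k - s * P k)               ∎
      P∙y≈0 : P ∙ y ≈ 0#
      P∙y≈0 = begin
        P ∙ y                                   ≈⟨ trans (∙-⊝ʳ P x (s • P)) (+-congˡ (-‿cong (trans (∙-•ʳ P s P) (*-congˡ P∙P≈n)))) ⟩
        P ∙ x - ((P ∙ x) * fromℕ n ⁻¹) * fromℕ n ≈⟨ +-congˡ (-‿cong (trans (*-assoc _ _ _) (*-congˡ (trans (*-comm _ _) (*-inverseʳ n≉0))))) ⟩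
        P ∙ x - (P ∙ x) * 1#                    ≈⟨ solve 1 (λ x → x :- x :* con ℤ.1ℤ := con ℤ.0ℤ) refl (P ∙ x) ⟩
        0#                                      ∎

    -- Symmetry of L gives (P ∙ x) (μ - n) = 0, so an eigenvector not orthogonal to P has eigenvalue
    -- n.
    eigenvalue-dichotomy : ∀ μ x → Eigenspace L μ x → ¬ x ≋ 𝟎 → μ ≈ fromℕ n ⊎ μ ≤ h
    eigenvalue-dichotomy μ x Lx≋μx x≉𝟎 with P ∙ x ≟ 0#
    ... | yes P∙x≈0 = inj₂ (orthogonal-eigenvalue Lx≋μx P∙x≈0 x≉𝟎)
    ... | no  P∙x≉0 = inj₁ (begin
      μ                       ≈⟨ solve 2 (λ m n → m := (m :- n) :+ n) refl μ (fromℕ n) ⟩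
      (μ - fromℕ n) + fromℕ n ≈⟨ +-congʳ (x≉0∧xy≈0⇒y≈0 P∙x≉0 product≈0) ⟩
      0# + fromℕ n            ≈⟨ +-identityˡ _ ⟩
      fromℕ n                 ∎)
      where
      product≈0 : (P ∙ x) * (μ - fromℕ n) ≈ 0#
      product≈0 = begin
        (P ∙ x) * (μ - fromℕ n)          ≈⟨ solve 3 (λ a b c → a :* (b :- c) := b :* a :- c :* a) refl (P ∙ x) μ (fromℕ n) ⟩
        μ * (P ∙ x) - fromℕ n * (P ∙ x)  ≈⟨ +-cong (∙-•ʳ P μ x) (-‿cong (∙-•ˡ (fromℕ n) P x)) ⟨
        P ∙ (μ • x) - (fromℕ n • P) ∙ x  ≈⟨ +-cong (∙-cong {x = P} (λ _ → refl) Lx≋μx) (-‿cong (∙-cong {y = x} P-eigenvector (λ _ → refl))) ⟨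
        P ∙ (L · x) - (L · P) ∙ x        ≈⟨ +-congˡ (-‿cong (stiffness-symmetric p P x)) ⟩
        P ∙ (L · x) - P ∙ (L · x)        ≈⟨ -‿inverseʳ _ ⟩
        0#                               ∎

    module HalfEigenvector (u v : Fin n) where

      private
        a : Vector Carrier n
        a i = fromℕ n * (𝟏 u i - 𝟏 v i)

      blocks : Vector (Vector Carrier d) n
      blocks i = (a i • p i) ⊝ (p u ⊝ p v)

      -- Here ∑ a = 0, so the radial formula leaves n times the difference of aᵢ pᵢ and the mean of
      -- the aⱼ pⱼ. The factor n in `a` makes that mean equal to `p u ⊝ p v` without any division.
      eigenvector : Eigenspace L h (flatten blocks)
      eigenvector = radial-eigenvector p unit centred h a (flatten blocks)
        (λ i j k → trans (+-cong (block-flatten blocks i k) (-‿cong (block-flatten blocks j k)))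
          (solve 3 (λ x y z → (x :- z) :- (y :- z) := x :- y) refl (a i * p i k) (a j * p j k) (p u k - p v k)))
        (λ i k → begin
          (fromℕ n * a i + sum a) * p i k - (sum λ j → a j * p j k)
            ≈⟨ +-cong (*-congʳ (+-congˡ sum-a)) (-‿cong (sum-ap k)) ⟩
          (fromℕ n * a i + fromℕ n * (1# - 1#)) * p i k - fromℕ n * (p u k - p v k)
            ≈⟨ solve 4 (λ n a p q → (n :* a :+ n :* (con ℤ.1ℤ :- con ℤ.1ℤ)) :* p :- n :* q := n :* (a :* p :- q)) refl (fromℕ n) (a i) (p i k) (p u k - p v k) ⟩
          fromℕ n * blocks i k
            ≈⟨ *-cong 2h≈n (block-flatten blocks i k) ⟨
          (2# * h) * block {n} (flatten blocks) i k ∎)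
        where
        sum-a* : ∀ (f : Vector Carrier n) → (sum λ j → a j * f j) ≈ fromℕ n * (f u - f v)
        sum-a* f = begin
          (sum λ j → a j * f j)
            ≈⟨ sum-cong-≋ (λ j → solve 4 (λ n x y f → (n :* (x :- y)) :* f := n :* (x :* f :- y :* f)) refl (fromℕ n) (𝟏 u j) (𝟏 v j) (f j)) ⟩
          (sum λ j → fromℕ n * (𝟏 u j * f j - 𝟏 v j * f j))
            ≈⟨ *-distribˡ-sum (fromℕ n) (λ j → 𝟏 u j * f j - 𝟏 v j * f j) ⟨
          fromℕ n * (sum λ j → 𝟏 u j * f j - 𝟏 v j * f j)
            ≈⟨ *-congˡ (trans (sum-sub (λ j → 𝟏 u j * f j) (λ j → 𝟏 v j * f j)) (+-cong (sum-𝟏ˡ u f) (-‿cong (sum-𝟏ˡ v f)))) ⟩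
          fromℕ n * (f u - f v) ∎
        sum-a : sum a ≈ fromℕ n * (1# - 1#)
        sum-a = trans (sum-cong-≋ λ j → sym (*-identityʳ (a j))) (sum-a* (λ _ → 1#))
        sum-ap : ∀ k → (sum λ j → a j * p j k) ≈ fromℕ n * (p u k - p v k)
        sum-ap k = sum-a* (λ j → p j k)

      nonzero : ∀ {w} → ¬ u ≡ w → ¬ v ≡ w → ¬ p u ≋ p v → ¬ flatten blocks ≋ 𝟎
      nonzero {w} u≢w v≢w pᵤ≉pᵥ blocks≋𝟎 = pᵤ≉pᵥ (⊝≈0⇒≋ λ k → begin
        p u k - p v k
          ≈⟨ solve 3 (λ n p q → q := :- ((n :* (con ℤ.0ℤ :- con ℤ.0ℤ)) :* p :- q)) refl (fromℕ n) (p w k) (p u k - p v k) ⟩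
        - ((fromℕ n * (0# - 0#)) * p w k - (p u k - p v k))
          ≈⟨ -‿cong (+-congʳ (*-congʳ (*-congˡ (+-cong (𝟏-offDiagonal u≢w) (-‿cong (𝟏-offDiagonal v≢w)))))) ⟨
        - blocks w k
          ≈⟨ -‿cong (trans (sym (block-flatten blocks w k)) (blocks≋𝟎 (Fin.combine w k))) ⟩
        - 0#
          ≈⟨ solve 0 (:- con ℤ.0ℤ := con ℤ.0ℤ) refl ⟩
        0# ∎)

theorem1 : ∀ {c ℓ} (ℝ : CompleteOrderedField c ℓ) →
    let open CompleteOrderedField ℝ
        open EuclideanSpace ℝ
        open Rigidity ℝ
    in
    ∀ {n d : ℕ} → 2 ℕ.≤ d →
    (p : Vector (Vector Carrier d) n) →
    (∀ i → ‖ p i ‖ ≈ 1#) →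
    ∑ p ≋ 𝟎 →
    (∃[ i ] ∃[ j ] ∃[ k ] ¬ (p i ≋ p j) × ¬ (p i ≋ p k) × ¬ (p j ≋ p k)) →
    (v : Vector Carrier (n ℕ.* d)) → IsEigenvalueList (stiffnessMatrix p) v →
    ∃[ k ] toℕ k ≡ 1 × v k ≈ fromℕ n * (1# + 1#) ⁻¹
theorem1 ℝ {n = suc n} 2≤d p norm centred (i , j , k , pᵢ≉pⱼ , pᵢ≉pₖ , pⱼ≉pₖ) v isList =
  secondEntry isList P-eigenvector′ P≉𝟎′ simple eigenvector
    -- The third of the distinct points supplies a vertex k different from i and j, as equal indices
    -- would carry equal points.
    (nonzero (distinct pᵢ≉pₖ) (distinct pⱼ≉pₖ) pᵢ≉pⱼ)
    (n≰h p unit centred n≉0) (eigenvalue-dichotomy p unit centred n≉0)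
  where
  open CompleteOrderedField ℝ using (refl)
  open OrderedField ℝ using (fromℕ-suc≉0)
  open EigenvalueLists ℝ using (secondEntry)
  open StiffnessSpectrum ℝ
  -- The vertex i already rules out an empty vertex set, which is why only a successor is matched.
  n≉0 = fromℕ-suc≉0 n
  unit = λ i → ‖x‖≈1⇒x∙x≈1 (p i) (norm i)
  P-eigenvector′ = P-eigenvector p unit centred n≉0
  P≉𝟎′ = P≉𝟎 p unit centred n≉0
  distinct : ∀ {i j} → ¬ EuclideanSpace._≋_ ℝ (p i) (p j) → ¬ i ≡ j
  distinct pᵢ≉pⱼ ≡.refl = pᵢ≉pⱼ λ _ → refl
  simple = n-simple p unit centred n≉0
  open HalfEigenvector p unit centred n≉0 i j
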